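{- Let $\tau=\sigma$ be a continuous equation. Then $\tau=\sigma$ is satisfied by every continuous algebra if and only if it is satisfied by the continuous algebra $[0,1]$, i.e. by $([0,1],\oplus,\neg,0,\kappa)$ with $x\oplus y=\min\{1,x+y\}$, $\neg x=1-x$, $\kappa x=\frac{x+1}{2}$.
   Context: A continuous algebra is a tuple $(A,\oplus,\neg,\bar 0,\kappa)$, where $\oplus$ is a binary operation on $A$, $\bar 0\in A$, and $\neg,\kappa$ are unary operations on $A$, such that for all $x,y,z\in A$: (C1) $x\oplus(y\oplus z)=(x\oplus y)\oplus z$; (C2) $x\oplus y=y\oplus x$; (C3) $x\oplus\bar 0=x$; (C4) $\neg\neg x=x$; (C5) $x\oplus\neg\bar 0=\neg\bar 0$; (C6) $\neg(\neg x\oplus y)\oplus y=\neg(\neg y\oplus x)\oplus x$; (C7) $\kappa x=x\oplus\neg\kappa x$; (C8) $(\neg\kappa x\oplus\kappa y)\oplus\neg(\neg x\oplus y)=\neg\bar 0$. For a natural number $t$, continuous terms on $S_t=\{\bar 0,\oplus,\neg,\kappa,(,),x_1,\dots,x_t\}$ are the strings generated inductively by: each variable $x_m$ ($1\le m\le t$) is a term; $\bar 0$ is a term; if $\tau_1,\tau_2$ are terms then so are $(\tau_1\oplus\tau_2)$, $\neg\tau_1$ and $\kappa\tau_1$. A continuous equation is a pair of continuous terms (on a common $S_n$), written $\tau=\sigma$. For a continuous algebra with underlying set $A$ and $a_1,\dots,a_n\in A$, $\tau^A(a_1,\dots,a_n)$ denotes the element of $A$ obtained by substituting $a_i$ for $x_i$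 and interpreting the symbols by the operations of the algebra. The algebra satisfies $\tau=\sigma$ if $\tau^A(a_1,\dots,a_n)=\sigma^A(a_1,\dots,a_n)$ for all $a_1,\dots,a_n\in A$. -}

module Defs where

open import Algebra.Definitions using (Congruent₁; Congruent₂)
open import Data.Fin using (Fin)
open import Data.Nat as ℕ using (ℕ)
import Data.Nat.Properties as ℕₚ
open import Data.Product using (_,_; ∃-syntax)
open import Data.Rational using (ℚ; 0ℚ; 1ℚ; ½; _+_; _*_; _-_; -_; _⊓_; _⊔_; _≤_; _<_; ∣_∣)
open import Data.Rational.Properties
open import Data.Rational.Solver using (module +-*-Solver)
open import Data.Sum using (inj₁; inj₂)
open import Data.Vec.Functional using (Vector)
open import Level using (Level; 0ℓ) renaming (suc to lsuc; _⊔_ to _⊔ˡ_)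
open import Relation.Binary.Core using (Rel)
open import Relation.Binary.PropositionalEquality using (_≡_; refl; sym; trans; cong; subst; subst₂; module ≡-Reasoning)
open import Relation.Binary.Structures using (IsEquivalence)

-- Equality is an equivalence relation _≈_ respected by the operations, as in
-- Algebra.Bundles; the equality of real numbers is of this kind.
record ContinuousAlgebra (c ℓ : Level) : Set (lsuc (c ⊔ˡ ℓ)) where
  infix  4 _≈_
  infixl 6 _⊕_
  infix  8 ¬_
  field
    Carrier       : Set c
    _≈_           : Rel Carrier ℓ
    _⊕_           : Carrier → Carrier → Carrier
    ¬_            : Carrier → Carrier
    0̄             : Carrier
    κ             : Carrier → Carrier
    isEquivalence : IsEquivalence _≈_
    ⊕-cong        : Congruent₂ _≈_ _⊕_
    ¬-cong        : Congruent₁ _≈_ ¬_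
    κ-cong        : Congruent₁ _≈_ κ
    C1            : ∀ x y z → x ⊕ (y ⊕ z) ≈ (x ⊕ y) ⊕ z
    C2            : ∀ x y → x ⊕ y ≈ y ⊕ x
    C3            : ∀ x → x ⊕ 0̄ ≈ x
    C4            : ∀ x → ¬ (¬ x) ≈ x
    C5            : ∀ x → x ⊕ ¬ 0̄ ≈ ¬ 0̄
    C6            : ∀ x y → ¬ (¬ x ⊕ y) ⊕ y ≈ ¬ (¬ y ⊕ x) ⊕ x
    C7            : ∀ x → κ x ≈ x ⊕ ¬ (κ x)
    C8            : ∀ x y → (¬ (κ x) ⊕ κ y) ⊕ ¬ (¬ x ⊕ y) ≈ ¬ 0̄

infixl 6 _`⊕_
infixr 8 `¬_ `κ_

data Term (t : ℕ) : Set where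
  var  : Fin t → Term t
  `0   : Term t
  _`⊕_ : Term t → Term t → Term t
  `¬_  : Term t → Term t
  `κ_  : Term t → Term t

infix 5 _≐_

record Equation (t : ℕ) : Set where
  constructor _≐_
  field
    lhs rhs : Term t

module _ {c ℓ : Level} (A : ContinuousAlgebra c ℓ) where
  open ContinuousAlgebra A

  eval : ∀ {t} → Term t → Vector Carrier t → Carrier
  eval (var i)  a = a i
  eval `0       a = 0̄
  eval (τ `⊕ σ) a = eval τ a ⊕ eval σ a
  eval (`¬ τ)   a = ¬ (eval τ a)
  eval (`κ τ)   a = κ (eval τ a)

infix 4 _⊨_

_⊨_ : ∀ {c ℓ t} → ContinuousAlgebra c ℓ → Equation t → Set (c ⊔ˡ ℓ)
A ⊨ τ ≐ σ = ∀ a → eval A τ a ≈ eval A σ a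
  where open ContinuousAlgebra A using (_≈_)

open +-*-Solver

≤-from-diff : ∀ {p q} d → 0ℚ ≤ d → p + d ≡ q → p ≤ q
≤-from-diff {p} {q} d 0≤d eq = subst₂ _≤_ (+-identityʳ p) eq (+-monoʳ-≤ p 0≤d)

diff≥0 : ∀ {p q} → p ≤ q → 0ℚ ≤ q - p
diff≥0 {p} {q} p≤q = subst (_≤ q - p) (+-inverseʳ p) (+-monoˡ-≤ (- p) p≤q)

p≤p+ε : ∀ p {ε} → 0ℚ ≤ ε → p ≤ p + ε
p≤p+ε p {ε} 0≤ε = ≤-from-diff ε 0≤ε refl

p≤∣p∣ : ∀ p → p ≤ ∣ p ∣
p≤∣p∣ p with ≤-total 0ℚ p
... | inj₁ 0≤p = ≤-reflexive (sym (0≤p⇒∣p∣≡p 0≤p))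
... | inj₂ p≤0 = ≤-trans p≤0 (0≤∣p∣ p)

∣p∣≤ : ∀ {p ε} → p ≤ ε → - p ≤ ε → ∣ p ∣ ≤ ε
∣p∣≤ {p} h k with ∣p∣≡p∨∣p∣≡-p p
... | inj₁ eq = subst (_≤ _) (sym eq) h
... | inj₂ eq = subst (_≤ _) (sym eq) k

near-sym : ∀ p q {ε} → ∣ p - q ∣ ≤ ε → ∣ q - p ∣ ≤ ε
near-sym p q h = subst (_≤ _) (trans (sym (∣-p∣≡∣p∣ (p - q))) (cong ∣_∣ eq)) h
  where
  eq : - (p - q) ≡ q - p
  eq = solve 2 (λ p q → :- (p :- q) := q :- p) refl p q

near⇒≤ : ∀ p q {ε} → ∣ p - q ∣ ≤ ε → p ≤ q + ε
near⇒≤ p q {ε} h = ≤-from-diff (ε - (p - q)) (diff≥0 (≤-trans (p≤∣p∣ (p - q)) h))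
  (solve 3 (λ p q ε → p :+ (ε :- (p :- q)) := q :+ ε) refl p q ε)

≤⇒near : ∀ p q {ε} → p ≤ q + ε → q ≤ p + ε → ∣ p - q ∣ ≤ ε
≤⇒near p q {ε} h k = ∣p∣≤
  (≤-from-diff ((q + ε) - p) (diff≥0 h)
    (solve 3 (λ p q ε → (p :- q) :+ ((q :+ ε) :- p) := ε) refl p q ε))
  (≤-from-diff ((p + ε) - q) (diff≥0 k)
    (solve 3 (λ p q ε → (:- (p :- q)) :+ ((p :+ ε) :- q) := ε) refl p q ε))

near-refl : ∀ {p q ε} → 0ℚ ≤ ε → p ≡ q → ∣ p - q ∣ ≤ ε
near-refl {p} 0≤ε refl = ≤⇒near p p (p≤p+ε p 0≤ε) (p≤p+ε p 0≤ε)

near-trans : ∀ p q r {ε δ} → ∣ p - q ∣ ≤ ε → ∣ q - r ∣ ≤ δ → ∣ p - r ∣ ≤ ε + δ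
near-trans p q r {ε} {δ} h k = subst (λ s → ∣ s ∣ ≤ ε + δ)
  (solve 3 (λ p q r → (p :- q) :+ (q :- r) := p :- r) refl p q r)
  (≤-trans (∣p+q∣≤∣p∣+∣q∣ (p - q) (q - r)) (+-mono-≤ h k))

near-+ : ∀ p q p′ q′ {ε δ} → ∣ p - p′ ∣ ≤ ε → ∣ q - q′ ∣ ≤ δ → ∣ (p + q) - (p′ + q′) ∣ ≤ ε + δ
near-+ p q p′ q′ {ε} {δ} h k = subst (λ s → ∣ s ∣ ≤ ε + δ)
  (solve 4 (λ p q p′ q′ → (p :- p′) :+ (q :- q′) := (p :+ q) :- (p′ :+ q′)) refl p q p′ q′)
  (≤-trans (∣p+q∣≤∣p∣+∣q∣ (p - p′) (q - q′)) (+-mono-≤ h k))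

near-neg : ∀ p q {ε} → ∣ p - q ∣ ≤ ε → ∣ (- p) - (- q) ∣ ≤ ε
near-neg p q h = subst (λ s → ∣ s ∣ ≤ _)
  (solve 2 (λ p q → q :- p := (:- p) :- (:- q)) refl p q) (near-sym p q h)

½≥0 : ∀ {p} → 0ℚ ≤ p → 0ℚ ≤ ½ * p
½≥0 {p} 0≤p = subst (_≤ ½ * p) (*-zeroʳ ½) (*-monoˡ-≤-nonNeg ½ 0≤p)

½p+½p≡p : ∀ p → ½ * p + ½ * p ≡ p
½p+½p≡p p = solve 1 (λ p → con ½ :* p :+ con ½ :* p := p) refl p

½p≤p : ∀ {p} → 0ℚ ≤ p → ½ * p ≤ p
½p≤p {p} 0≤p = ≤-from-diff (½ * p) (½≥0 0≤p) (½p+½p≡p p)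

½>0 : ∀ {ε} → 0ℚ < ε → 0ℚ < ½ * ε
½>0 {ε} 0<ε = subst (_< ½ * ε) (*-zeroʳ ½) (*-monoʳ-<-pos ½ 0<ε)

near-½ : ∀ p q {ε} → ∣ p - q ∣ ≤ ε → ∣ ½ * p - ½ * q ∣ ≤ ε
near-½ p q {ε} h = subst (_≤ ε)
  (trans (sym (∣p*q∣≡∣p∣*∣q∣ ½ (p - q)))
    (cong ∣_∣ (solve 2 (λ p q → con ½ :* (p :- q) := con ½ :* p :- con ½ :* q) refl p q)))
  (≤-trans (½p≤p (0≤∣p∣ (p - q))) h)

⊓-≤+ : ∀ p q p′ q′ {ε} → p ≤ p′ + ε → q ≤ q′ + ε → p ⊓ q ≤ (p′ ⊓ q′) + ε
⊓-≤+ p q p′ q′ {ε} h k with ⊓-sel p′ q′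
... | inj₁ eq = subst (λ s → p ⊓ q ≤ s + ε) (sym eq) (≤-trans (p⊓q≤p p q) h)
... | inj₂ eq = subst (λ s → p ⊓ q ≤ s + ε) (sym eq) (≤-trans (p⊓q≤q p q) k)

near-⊓ : ∀ p q p′ q′ {ε} → ∣ p - p′ ∣ ≤ ε → ∣ q - q′ ∣ ≤ ε → ∣ (p ⊓ q) - (p′ ⊓ q′) ∣ ≤ ε
near-⊓ p q p′ q′ h k = ≤⇒near (p ⊓ q) (p′ ⊓ q′)
  (⊓-≤+ p q p′ q′ (near⇒≤ p p′ h) (near⇒≤ q q′ k))
  (⊓-≤+ p′ q′ p q (near⇒≤ p′ p (near-sym p p′ h)) (near⇒≤ q′ q (near-sym q q′ k)))

-- Real numbers are Cauchy sequences of rationals, identified by _≃ᴿ_ when they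
-- differ by a null sequence.
IsCauchy : (ℕ → ℚ) → Set
IsCauchy s = ∀ ε → 0ℚ < ε → ∃[ N ] (∀ m n → N ℕ.≤ m → N ℕ.≤ n → ∣ s m - s n ∣ ≤ ε)

record ℝ : Set where
  constructor mkℝ
  field
    seq    : ℕ → ℚ
    cauchy : IsCauchy seq

open ℝ public

Eventually : (ℕ → Set) → Set
Eventually P = ∃[ N ] (∀ n → N ℕ.≤ n → P n)

infix 4 _≃ᴿ_ _≤ᴿ_

_≃ᴿ_ : ℝ → ℝ → Set
x ≃ᴿ y = ∀ ε → 0ℚ < ε → Eventually λ n → ∣ seq x n - seq y n ∣ ≤ ε

_≤ᴿ_ : ℝ → ℝ → Set
x ≤ᴿ y = ∀ ε → 0ℚ < ε → Eventually λ n → seq x n ≤ seq y n + ε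

ev-zip : ∀ {P Q R : ℕ → Set} → (∀ n → P n → Q n → R n) → Eventually P → Eventually Q → Eventually R
ev-zip f (M , p) (N , q) = M ℕ.⊔ N , λ n h →
  f n (p n (ℕₚ.≤-trans (ℕₚ.m≤m⊔n M N) h)) (q n (ℕₚ.≤-trans (ℕₚ.m≤n⊔m M N) h))

ev-map : ∀ {P Q : ℕ → Set} → (∀ n → P n → Q n) → Eventually P → Eventually Q
ev-map f (N , p) = N , λ n h → f n (p n h)

always : ∀ {P : ℕ → Set} → (∀ n → P n) → Eventually P
always p = 0 , λ n _ → p n

fromℚ : ℚ → ℝ
fromℚ q = mkℝ (λ _ → q) λ ε 0<ε → 0 , λ _ _ _ _ → near-refl {q} (<⇒≤ 0<ε) refl

0ᴿ 1ᴿ : ℝ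
0ᴿ = fromℚ 0ℚ
1ᴿ = fromℚ 1ℚ

infixl 6 _+ᴿ_ _-ᴿ_
infix  8 -ᴿ_

_+ᴿ_ : ℝ → ℝ → ℝ
x +ᴿ y = mkℝ (λ n → seq x n + seq y n) λ ε 0<ε →
  let M , p = cauchy x (½ * ε) (½>0 0<ε)
      N , q = cauchy y (½ * ε) (½>0 0<ε)
  in M ℕ.⊔ N , λ m n hm hn → subst (∣ (seq x m + seq y m) - (seq x n + seq y n) ∣ ≤_) (½p+½p≡p ε)
       (near-+ (seq x m) (seq y m) (seq x n) (seq y n)
         (p m n (ℕₚ.≤-trans (ℕₚ.m≤m⊔n M N) hm) (ℕₚ.≤-trans (ℕₚ.m≤m⊔n M N) hn))
         (q m n (ℕₚ.≤-trans (ℕₚ.m≤n⊔m M N) hm) (ℕₚ.≤-trans (ℕₚ.m≤n⊔m M N) hn)))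

-ᴿ_ : ℝ → ℝ
-ᴿ x = mkℝ (λ n → - seq x n) λ ε 0<ε →
  let N , p = cauchy x ε 0<ε
  in N , λ m n hm hn → near-neg (seq x m) (seq x n) (p m n hm hn)

_-ᴿ_ : ℝ → ℝ → ℝ
x -ᴿ y = x +ᴿ (-ᴿ y)

minᴿ : ℝ → ℝ → ℝ
minᴿ x y = mkℝ (λ n → seq x n ⊓ seq y n) λ ε 0<ε →
  let M , p = cauchy x ε 0<ε
      N , q = cauchy y ε 0<ε
  in M ℕ.⊔ N , λ m n hm hn → near-⊓ (seq x m) (seq y m) (seq x n) (seq y n)
       (p m n (ℕₚ.≤-trans (ℕₚ.m≤m⊔n M N) hm) (ℕₚ.≤-trans (ℕₚ.m≤m⊔n M N) hn))
       (q m n (ℕₚ.≤-trans (ℕₚ.m≤n⊔m M N) hm) (ℕₚ.≤-trans (ℕₚ.m≤n⊔m M N) hn))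

infixl 7 _/2

_/2 : ℝ → ℝ
x /2 = mkℝ (λ n → ½ * seq x n) λ ε 0<ε →
  let N , p = cauchy x ε 0<ε
  in N , λ m n hm hn → near-½ (seq x m) (seq x n) (p m n hm hn)

pointwise⇒≃ : ∀ {x y} → (∀ n → seq x n ≡ seq y n) → x ≃ᴿ y
pointwise⇒≃ eq ε 0<ε = always λ n → near-refl (<⇒≤ 0<ε) (eq n)

≃ᴿ-refl : ∀ {x} → x ≃ᴿ x
≃ᴿ-refl {x} = pointwise⇒≃ {x} {x} λ _ → refl

≃ᴿ-sym : ∀ {x y} → x ≃ᴿ y → y ≃ᴿ x
≃ᴿ-sym {x} {y} h ε 0<ε = ev-map (λ n → near-sym (seq x n) (seq y n)) (h ε 0<ε)

≃ᴿ-trans : ∀ {x y z} → x ≃ᴿ y → y ≃ᴿ z → x ≃ᴿ z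
≃ᴿ-trans {x} {y} {z} h k ε 0<ε = ev-zip
  (λ n p q → subst (∣ seq x n - seq z n ∣ ≤_) (½p+½p≡p ε) (near-trans (seq x n) (seq y n) (seq z n) p q))
  (h (½ * ε) (½>0 0<ε)) (k (½ * ε) (½>0 0<ε))

+ᴿ-cong : ∀ {x x′ y y′} → x ≃ᴿ x′ → y ≃ᴿ y′ → x +ᴿ y ≃ᴿ x′ +ᴿ y′
+ᴿ-cong {x} {x′} {y} {y′} h k ε 0<ε = ev-zip
  (λ n p q → subst (∣ (seq x n + seq y n) - (seq x′ n + seq y′ n) ∣ ≤_) (½p+½p≡p ε)
    (near-+ (seq x n) (seq y n) (seq x′ n) (seq y′ n) p q))
  (h (½ * ε) (½>0 0<ε)) (k (½ * ε) (½>0 0<ε))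

-ᴿ-cong : ∀ {x y} → x ≃ᴿ y → -ᴿ x ≃ᴿ -ᴿ y
-ᴿ-cong {x} {y} h ε 0<ε = ev-map (λ n → near-neg (seq x n) (seq y n)) (h ε 0<ε)

minᴿ-cong : ∀ {x x′ y y′} → x ≃ᴿ x′ → y ≃ᴿ y′ → minᴿ x y ≃ᴿ minᴿ x′ y′
minᴿ-cong {x} {x′} {y} {y′} h k ε 0<ε = ev-zip
  (λ n → near-⊓ (seq x n) (seq y n) (seq x′ n) (seq y′ n)) (h ε 0<ε) (k ε 0<ε)

/2-cong : ∀ {x y} → x ≃ᴿ y → x /2 ≃ᴿ y /2
/2-cong {x} {y} h ε 0<ε = ev-map (λ n → near-½ (seq x n) (seq y n)) (h ε 0<ε)

record I : Set where
  constructor mkI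
  field
    real : ℝ
    0≤   : 0ᴿ ≤ᴿ real
    ≤1   : real ≤ᴿ 1ᴿ

open I public

infix  4 _≃ᴵ_
infixl 6 _⊕ᴵ_
infix  8 ¬ᴵ_

_≃ᴵ_ : I → I → Set
x ≃ᴵ y = real x ≃ᴿ real y

0ᴵ : I
0ᴵ = mkI 0ᴿ
  (λ ε 0<ε → always λ _ → p≤p+ε 0ℚ (<⇒≤ 0<ε))
  (λ ε 0<ε → always λ _ → ≤-trans 0≤1 (p≤p+ε 1ℚ (<⇒≤ 0<ε)))
  where
  0≤1 : 0ℚ ≤ 1ℚ
  0≤1 = <⇒≤ (positive⁻¹ 1ℚ)

_⊕ᴵ_ : I → I → I
x ⊕ᴵ y = mkI (minᴿ 1ᴿ (real x +ᴿ real y))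
  (λ ε 0<ε → ev-zip (λ n → lower ε 0<ε (seq (real x) n) (seq (real y) n))
    (0≤ x (½ * ε) (½>0 0<ε)) (0≤ y (½ * ε) (½>0 0<ε)))
  (λ ε 0<ε → always λ n → ≤-trans (p⊓q≤p 1ℚ (seq (real x) n + seq (real y) n)) (p≤p+ε 1ℚ (<⇒≤ 0<ε)))
  where
  lower : ∀ ε → 0ℚ < ε → ∀ p q → 0ℚ ≤ p + ½ * ε → 0ℚ ≤ q + ½ * ε → 0ℚ ≤ (1ℚ ⊓ (p + q)) + ε
  lower ε 0<ε p q h k = ⊓-≤+ 0ℚ 0ℚ 1ℚ (p + q)
    (≤-trans (<⇒≤ (positive⁻¹ 1ℚ)) (p≤p+ε 1ℚ (<⇒≤ 0<ε)))
    (≤-from-diff ((p + ½ * ε) + (q + ½ * ε)) (+-mono-≤ h k)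
      (solve 3 (λ p q ε → con 0ℚ :+ ((p :+ con ½ :* ε) :+ (q :+ con ½ :* ε)) := (p :+ q) :+ ε) refl p q ε))

¬ᴵ_ : I → I
¬ᴵ x = mkI (1ᴿ -ᴿ real x)
  (λ ε 0<ε → ev-map (λ n h → ≤-from-diff ((1ℚ + ε) - seq (real x) n) (diff≥0 h)
    (solve 2 (λ p ε → con 0ℚ :+ ((con 1ℚ :+ ε) :- p) := (con 1ℚ :- p) :+ ε) refl (seq (real x) n) ε)) (≤1 x ε 0<ε))
  (λ ε 0<ε → ev-map (λ n h → ≤-from-diff (seq (real x) n + ε) h
    (solve 2 (λ p ε → (con 1ℚ :- p) :+ (p :+ ε) := con 1ℚ :+ ε) refl (seq (real x) n) ε)) (0≤ x ε 0<ε))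

κᴵ : I → I
κᴵ x = mkI ((real x +ᴿ 1ᴿ) /2)
  (λ ε 0<ε → ev-map (λ n h → ≤-from-diff (½ * ((seq (real x) n + ε) + (1ℚ + ε)))
      (½≥0 (+-mono-≤ h (≤-trans (<⇒≤ (positive⁻¹ 1ℚ)) (p≤p+ε 1ℚ (<⇒≤ 0<ε)))))
      (solve 2 (λ p ε → con 0ℚ :+ con ½ :* ((p :+ ε) :+ (con 1ℚ :+ ε)) := con ½ :* (p :+ con 1ℚ) :+ ε) refl (seq (real x) n) ε))
    (0≤ x ε 0<ε))
  (λ ε 0<ε → ev-map (λ n h → ≤-from-diff (½ * (((1ℚ + ε) - seq (real x) n) + ε))
      (½≥0 (+-mono-≤ (diff≥0 h) (<⇒≤ 0<ε)))
      (solve 2 (λ p ε → con ½ :* (p :+ con 1ℚ) :+ con ½ :* (((con 1ℚ :+ ε) :- p) :+ ε) := con 1ℚ :+ ε) refl (seq (real x) n) ε))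
    (≤1 x ε 0<ε))

⊓-absorb : ∀ p s → 0ℚ ≤ p → 1ℚ ⊓ (p + (1ℚ ⊓ s)) ≡ 1ℚ ⊓ (p + s)
⊓-absorb p s 0≤p with ≤-total 1ℚ s
... | inj₂ s≤1 = cong (λ r → 1ℚ ⊓ (p + r)) (p≥q⇒p⊓q≡q s≤1)
... | inj₁ 1≤s = trans (cong (λ r → 1ℚ ⊓ (p + r)) (p≤q⇒p⊓q≡p 1≤s))
  (trans (p≤q⇒p⊓q≡p 1≤p+1) (sym (p≤q⇒p⊓q≡p (≤-trans 1≤p+1 (+-monoʳ-≤ p 1≤s)))))
  where
  1≤p+1 : 1ℚ ≤ p + 1ℚ
  1≤p+1 = ≤-from-diff p 0≤p (+-comm 1ℚ p)

C1ℚ : ∀ p q r → 0ℚ ≤ p → 0ℚ ≤ r → 1ℚ ⊓ (p + (1ℚ ⊓ (q + r))) ≡ 1ℚ ⊓ ((1ℚ ⊓ (p + q)) + r)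
C1ℚ p q r 0≤p 0≤r = begin
  1ℚ ⊓ (p + (1ℚ ⊓ (q + r)))  ≡⟨ ⊓-absorb p (q + r) 0≤p ⟩
  1ℚ ⊓ (p + (q + r))         ≡⟨ cong (1ℚ ⊓_) (solve 3 (λ p q r → p :+ (q :+ r) := r :+ (p :+ q)) refl p q r) ⟩
  1ℚ ⊓ (r + (p + q))         ≡⟨ ⊓-absorb r (p + q) 0≤r ⟨
  1ℚ ⊓ (r + (1ℚ ⊓ (p + q)))  ≡⟨ cong (1ℚ ⊓_) (+-comm r _) ⟩
  1ℚ ⊓ ((1ℚ ⊓ (p + q)) + r)  ∎
  where open ≡-Reasoning

¬¬ℚ : ∀ p → 1ℚ - (1ℚ - p) ≡ p
¬¬ℚ p = solve 1 (λ p → con 1ℚ :- (con 1ℚ :- p) := p) refl p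

C5ℚ : ∀ p → 0ℚ ≤ p → 1ℚ ⊓ (p + (1ℚ - 0ℚ)) ≡ 1ℚ - 0ℚ
C5ℚ p 0≤p = p≤q⇒p⊓q≡p (≤-from-diff p 0≤p (+-comm 1ℚ p))

∨ℚ : ∀ p q → (1ℚ - (1ℚ ⊓ ((1ℚ - p) + q))) + q ≡ p ⊔ q
∨ℚ p q with ≤-total p q
... | inj₁ p≤q = begin
  (1ℚ - (1ℚ ⊓ ((1ℚ - p) + q))) + q  ≡⟨ cong (λ s → (1ℚ - s) + q) (p≤q⇒p⊓q≡p le) ⟩
  (1ℚ - 1ℚ) + q                     ≡⟨ +-identityˡ q ⟩
  q                                 ≡⟨ p≤q⇒p⊔q≡q p≤q ⟨
  p ⊔ q                             ∎
  where
  open ≡-Reasoning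
  le : 1ℚ ≤ (1ℚ - p) + q
  le = ≤-from-diff (q - p) (diff≥0 p≤q)
    (solve 2 (λ p q → con 1ℚ :+ (q :- p) := (con 1ℚ :- p) :+ q) refl p q)
... | inj₂ q≤p = begin
  (1ℚ - (1ℚ ⊓ ((1ℚ - p) + q))) + q  ≡⟨ cong (λ s → (1ℚ - s) + q) (p≥q⇒p⊓q≡q ge) ⟩
  (1ℚ - ((1ℚ - p) + q)) + q         ≡⟨ solve 2 (λ p q → (con 1ℚ :- ((con 1ℚ :- p) :+ q)) :+ q := p) refl p q ⟩
  p                                 ≡⟨ p≥q⇒p⊔q≡p q≤p ⟨
  p ⊔ q                             ∎
  where
  open ≡-Reasoning
  ge : (1ℚ - p) + q ≤ 1ℚ
  ge = ≤-from-diff (p - q) (diff≥0 q≤p)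
    (solve 2 (λ p q → ((con 1ℚ :- p) :+ q) :+ (p :- q) := con 1ℚ) refl p q)

C6ℚ : ∀ p q → 1ℚ ⊓ ((1ℚ - (1ℚ ⊓ ((1ℚ - p) + q))) + q) ≡ 1ℚ ⊓ ((1ℚ - (1ℚ ⊓ ((1ℚ - q) + p))) + p)
C6ℚ p q = cong (1ℚ ⊓_) (trans (∨ℚ p q) (trans (⊔-comm p q) (sym (∨ℚ q p))))

C7ℚ : ∀ p → p ≤ 1ℚ → ½ * (p + 1ℚ) ≡ 1ℚ ⊓ (p + (1ℚ - ½ * (p + 1ℚ)))
C7ℚ p p≤1 = sym (trans (cong (1ℚ ⊓_) eq) (p≥q⇒p⊓q≡q le))
  where
  eq : p + (1ℚ - ½ * (p + 1ℚ)) ≡ ½ * (p + 1ℚ)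
  eq = solve 1 (λ p → p :+ (con 1ℚ :- con ½ :* (p :+ con 1ℚ)) := con ½ :* (p :+ con 1ℚ)) refl p
  le : ½ * (p + 1ℚ) ≤ 1ℚ
  le = ≤-from-diff (½ * (1ℚ - p)) (½≥0 (diff≥0 p≤1))
    (solve 1 (λ p → con ½ :* (p :+ con 1ℚ) :+ con ½ :* (con 1ℚ :- p) := con 1ℚ) refl p)

C8ℚ : ∀ p q → 1ℚ ⊓ ((1ℚ ⊓ ((1ℚ - ½ * (p + 1ℚ)) + ½ * (q + 1ℚ))) + (1ℚ - (1ℚ ⊓ ((1ℚ - p) + q)))) ≡ 1ℚ - 0ℚ
C8ℚ p q = p≤q⇒p⊓q≡p bound
  where
  u v : ℚ
  u = (1ℚ - ½ * (p + 1ℚ)) + ½ * (q + 1ℚ)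
  v = (1ℚ - p) + q
  bound : 1ℚ ≤ (1ℚ ⊓ u) + (1ℚ - (1ℚ ⊓ v))
  bound with ≤-total p q
  ... | inj₁ p≤q = subst (λ s → 1ℚ ≤ s + (1ℚ - (1ℚ ⊓ v))) (sym (p≤q⇒p⊓q≡p 1≤u))
    (p≤p+ε 1ℚ (diff≥0 (p⊓q≤p 1ℚ v)))
    where
    1≤u : 1ℚ ≤ u
    1≤u = ≤-from-diff (½ * (q - p)) (½≥0 (diff≥0 p≤q))
      (solve 2 (λ p q → con 1ℚ :+ con ½ :* (q :- p) := (con 1ℚ :- con ½ :* (p :+ con 1ℚ)) :+ con ½ :* (q :+ con 1ℚ)) refl p q)
  ... | inj₂ q≤p = subst₂ (λ s t → 1ℚ ≤ s + (1ℚ - t)) (sym (p≥q⇒p⊓q≡q u≤1)) (sym (p≥q⇒p⊓q≡q v≤1))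
    (≤-from-diff (½ * (p - q)) (½≥0 (diff≥0 q≤p))
      (solve 2 (λ p q → con 1ℚ :+ con ½ :* (p :- q) :=
        ((con 1ℚ :- con ½ :* (p :+ con 1ℚ)) :+ con ½ :* (q :+ con 1ℚ)) :+ (con 1ℚ :- ((con 1ℚ :- p) :+ q))) refl p q))
    where
    u≤1 : u ≤ 1ℚ
    u≤1 = ≤-from-diff (½ * (p - q)) (½≥0 (diff≥0 q≤p))
      (solve 2 (λ p q → ((con 1ℚ :- con ½ :* (p :+ con 1ℚ)) :+ con ½ :* (q :+ con 1ℚ)) :+ con ½ :* (p :- q) := con 1ℚ) refl p q)
    v≤1 : v ≤ 1ℚ
    v≤1 = ≤-from-diff (p - q) (diff≥0 q≤p)
      (solve 2 (λ p q → ((con 1ℚ :- p) :+ q) :+ (p :- q) := con 1ℚ) refl p q)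

-- A point of [0,1] may be represented by a sequence leaving [0,1]; clamp
-- replaces it by an equal one all of whose terms lie in [0,1], so that the
-- axioms can be checked termwise.
clampℚ : ℚ → ℚ
clampℚ p = - ((- 0ℚ) ⊓ (- (1ℚ ⊓ p)))

clampℚ≥0 : ∀ p → 0ℚ ≤ clampℚ p
clampℚ≥0 p = neg-antimono-≤ (p⊓q≤p (- 0ℚ) (- (1ℚ ⊓ p)))

clampℚ≤1 : ∀ p → clampℚ p ≤ 1ℚ
clampℚ≤1 p = subst (clampℚ p ≤_) (solve 0 (:- (:- con 1ℚ) := con 1ℚ) refl)
  (neg-antimono-≤ (⊓-glb (neg-antimono-≤ (<⇒≤ (positive⁻¹ 1ℚ))) (neg-antimono-≤ (p⊓q≤p 1ℚ p))))

clampℚ-near : ∀ p {ε} → 0ℚ < ε → 0ℚ ≤ p + ε → p ≤ 1ℚ + ε → ∣ p - clampℚ p ∣ ≤ ε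
clampℚ-near p {ε} 0<ε h k = ≤⇒near p (clampℚ p) low high
  where
  0≤ε : 0ℚ ≤ ε
  0≤ε = <⇒≤ 0<ε
  neg-neg : ∀ q → - (- q) ≡ q
  neg-neg q = solve 1 (λ q → :- (:- q) := q) refl q
  low : p ≤ clampℚ p + ε
  low = ≤-trans (subst (_≤ (1ℚ ⊓ p) + ε) (⊓-idem p) (⊓-≤+ p p 1ℚ p k (p≤p+ε p 0≤ε)))
    (+-monoˡ-≤ ε (subst (_≤ clampℚ p) (neg-neg (1ℚ ⊓ p)) (neg-antimono-≤ (p⊓q≤q (- 0ℚ) (- (1ℚ ⊓ p))))))
  high : clampℚ p ≤ p + ε
  high with ⊓-sel (- 0ℚ) (- (1ℚ ⊓ p))
  ... | inj₁ eq = subst (λ r → - r ≤ p + ε) (sym eq) h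
  ... | inj₂ eq = subst (λ r → - r ≤ p + ε) (sym eq)
    (subst (_≤ p + ε) (sym (neg-neg (1ℚ ⊓ p))) (≤-trans (p⊓q≤q 1ℚ p) (p≤p+ε p 0≤ε)))

clamp : I → I
clamp x = mkI (-ᴿ (minᴿ (-ᴿ 0ᴿ) (-ᴿ (minᴿ 1ᴿ (real x)))))
  (λ ε 0<ε → always λ n → ≤-trans (clampℚ≥0 (seq (real x) n)) (p≤p+ε _ (<⇒≤ 0<ε)))
  (λ ε 0<ε → always λ n → ≤-trans (clampℚ≤1 (seq (real x) n)) (p≤p+ε _ (<⇒≤ 0<ε)))

clamp-≃ : ∀ x → x ≃ᴵ clamp x
clamp-≃ x ε 0<ε = ev-zip (λ n → clampℚ-near (seq (real x) n) 0<ε) (0≤ x ε 0<ε) (≤1 x ε 0<ε)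

≃ᴵ-isEquivalence : IsEquivalence _≃ᴵ_
≃ᴵ-isEquivalence = record
  { refl  = λ {x} → ≃ᴿ-refl {real x}
  ; sym   = λ {x} {y} → ≃ᴿ-sym {real x} {real y}
  ; trans = λ {x} {y} {z} → ≃ᴿ-trans {real x} {real y} {real z}
  }

⊕ᴵ-cong : Congruent₂ _≃ᴵ_ _⊕ᴵ_
⊕ᴵ-cong {x} {x′} {y} {y′} h k =
  minᴿ-cong {1ᴿ} {1ᴿ} {real x +ᴿ real y} {real x′ +ᴿ real y′} (≃ᴿ-refl {1ᴿ})
    (+ᴿ-cong {real x} {real x′} {real y} {real y′} h k)

¬ᴵ-cong : Congruent₁ _≃ᴵ_ ¬ᴵ_
¬ᴵ-cong {x} {y} h = +ᴿ-cong {1ᴿ} {1ᴿ} { -ᴿ real x} { -ᴿ real y} (≃ᴿ-refl {1ᴿ}) (-ᴿ-cong {real x} {real y} h)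

κᴵ-cong : Congruent₁ _≃ᴵ_ κᴵ
κᴵ-cong {x} {y} h = /2-cong {real x +ᴿ 1ᴿ} {real y +ᴿ 1ᴿ} (+ᴿ-cong {real x} {real y} {1ᴿ} {1ᴿ} h (≃ᴿ-refl {1ᴿ}))

termwise : ∀ x y → (∀ n → seq (real x) n ≡ seq (real y) n) → x ≃ᴵ y
termwise x y = pointwise⇒≃ {real x} {real y}

-- An identity between operations respecting ≃ᴵ may be checked on clamped points.
viaClamp : (f g : I → I) → Congruent₁ _≃ᴵ_ f → Congruent₁ _≃ᴵ_ g → ∀ x → f (clamp x) ≃ᴵ g (clamp x) → f x ≃ᴵ g x
viaClamp f g f-cong g-cong x h =
  ≃ᴿ-trans {real (f x)} {real (f (clamp x))} {real (g x)} (f-cong {x} {clamp x} (clamp-≃ x))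
    (≃ᴿ-trans {real (f (clamp x))} {real (g (clamp x))} {real (g x)} h
      (≃ᴿ-sym {real (g x)} {real (g (clamp x))} (g-cong {x} {clamp x} (clamp-≃ x))))

⊕ᴵ-congˡ : ∀ z {x y} → x ≃ᴵ y → z ⊕ᴵ x ≃ᴵ z ⊕ᴵ y
⊕ᴵ-congˡ z {x} {y} h = ⊕ᴵ-cong {z} {z} {x} {y} (≃ᴿ-refl {real z}) h

⊕ᴵ-congʳ : ∀ z {x y} → x ≃ᴵ y → x ⊕ᴵ z ≃ᴵ y ⊕ᴵ z
⊕ᴵ-congʳ z {x} {y} h = ⊕ᴵ-cong {x} {y} {z} {z} h (≃ᴿ-refl {real z})

C1ᴵ : ∀ x y z → x ⊕ᴵ (y ⊕ᴵ z) ≃ᴵ (x ⊕ᴵ y) ⊕ᴵ z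
C1ᴵ x y z =
  viaClamp (λ x → x ⊕ᴵ (y ⊕ᴵ z)) (λ x → (x ⊕ᴵ y) ⊕ᴵ z)
    (λ {a} {b} → ⊕ᴵ-congʳ (y ⊕ᴵ z) {a} {b})
    (λ {a} {b} h → ⊕ᴵ-congʳ z {a ⊕ᴵ y} {b ⊕ᴵ y} (⊕ᴵ-congʳ y {a} {b} h)) x
  (viaClamp (λ z → clamp x ⊕ᴵ (y ⊕ᴵ z)) (λ z → (clamp x ⊕ᴵ y) ⊕ᴵ z)
    (λ {a} {b} h → ⊕ᴵ-congˡ (clamp x) {y ⊕ᴵ a} {y ⊕ᴵ b} (⊕ᴵ-congˡ y {a} {b} h))
    (λ {a} {b} → ⊕ᴵ-congˡ (clamp x ⊕ᴵ y) {a} {b}) z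
  (termwise (clamp x ⊕ᴵ (y ⊕ᴵ clamp z)) ((clamp x ⊕ᴵ y) ⊕ᴵ clamp z) λ n →
    C1ℚ _ (seq (real y) n) _ (clampℚ≥0 (seq (real x) n)) (clampℚ≥0 (seq (real z) n))))

C2ᴵ : ∀ x y → x ⊕ᴵ y ≃ᴵ y ⊕ᴵ x
C2ᴵ x y = termwise (x ⊕ᴵ y) (y ⊕ᴵ x) λ n → cong (1ℚ ⊓_) (+-comm (seq (real x) n) (seq (real y) n))

C3ᴵ : ∀ x → x ⊕ᴵ 0ᴵ ≃ᴵ x
C3ᴵ x = viaClamp (_⊕ᴵ 0ᴵ) (λ x → x) (λ {a} {b} → ⊕ᴵ-congʳ 0ᴵ {a} {b}) (λ h → h) x
  (termwise (clamp x ⊕ᴵ 0ᴵ) (clamp x) λ n →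
    trans (cong (1ℚ ⊓_) (+-identityʳ (clampℚ (seq (real x) n)))) (p≥q⇒p⊓q≡q (clampℚ≤1 (seq (real x) n))))

C4ᴵ : ∀ x → ¬ᴵ (¬ᴵ x) ≃ᴵ x
C4ᴵ x = termwise (¬ᴵ (¬ᴵ x)) x λ n → ¬¬ℚ (seq (real x) n)

C5ᴵ : ∀ x → x ⊕ᴵ ¬ᴵ 0ᴵ ≃ᴵ ¬ᴵ 0ᴵ
C5ᴵ x = viaClamp (_⊕ᴵ ¬ᴵ 0ᴵ) (λ _ → ¬ᴵ 0ᴵ) (λ {a} {b} → ⊕ᴵ-congʳ (¬ᴵ 0ᴵ) {a} {b}) (λ _ → ≃ᴿ-refl {real (¬ᴵ 0ᴵ)}) x
  (termwise (clamp x ⊕ᴵ ¬ᴵ 0ᴵ) (¬ᴵ 0ᴵ) λ n → C5ℚ _ (clampℚ≥0 (seq (real x) n)))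

C6ᴵ : ∀ x y → ¬ᴵ (¬ᴵ x ⊕ᴵ y) ⊕ᴵ y ≃ᴵ ¬ᴵ (¬ᴵ y ⊕ᴵ x) ⊕ᴵ x
C6ᴵ x y = termwise (¬ᴵ (¬ᴵ x ⊕ᴵ y) ⊕ᴵ y) (¬ᴵ (¬ᴵ y ⊕ᴵ x) ⊕ᴵ x) λ n → C6ℚ (seq (real x) n) (seq (real y) n)

C7ᴵ : ∀ x → κᴵ x ≃ᴵ x ⊕ᴵ ¬ᴵ (κᴵ x)
C7ᴵ x = viaClamp κᴵ (λ x → x ⊕ᴵ ¬ᴵ (κᴵ x)) (λ {a} {b} → κᴵ-cong {a} {b})
  (λ {a} {b} h → ⊕ᴵ-cong {a} {b} {¬ᴵ (κᴵ a)} {¬ᴵ (κᴵ b)} h (¬ᴵ-cong {κᴵ a} {κᴵ b} (κᴵ-cong {a} {b} h))) x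
  (termwise (κᴵ (clamp x)) (clamp x ⊕ᴵ ¬ᴵ (κᴵ (clamp x))) λ n → C7ℚ _ (clampℚ≤1 (seq (real x) n)))

C8ᴵ : ∀ x y → (¬ᴵ (κᴵ x) ⊕ᴵ κᴵ y) ⊕ᴵ ¬ᴵ (¬ᴵ x ⊕ᴵ y) ≃ᴵ ¬ᴵ 0ᴵ
C8ᴵ x y = termwise ((¬ᴵ (κᴵ x) ⊕ᴵ κᴵ y) ⊕ᴵ ¬ᴵ (¬ᴵ x ⊕ᴵ y)) (¬ᴵ 0ᴵ) λ n → C8ℚ (seq (real x) n) (seq (real y) n)

[0,1] : ContinuousAlgebra 0ℓ 0ℓ
[0,1] = record
  { Carrier       = I
  ; _≈_           = _≃ᴵ_
  ; _⊕_           = _⊕ᴵ_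
  ; ¬_            = ¬ᴵ_
  ; 0̄             = 0ᴵ
  ; κ             = κᴵ
  ; isEquivalence = ≃ᴵ-isEquivalence
  ; ⊕-cong        = λ {x} {x′} {y} {y′} → ⊕ᴵ-cong {x} {x′} {y} {y′}
  ; ¬-cong        = λ {x} {y} → ¬ᴵ-cong {x} {y}
  ; κ-cong        = λ {x} {y} → κᴵ-cong {x} {y}
  ; C1            = C1ᴵ
  ; C2            = C2ᴵ
  ; C3            = C3ᴵ
  ; C4            = C4ᴵ
  ; C5            = C5ᴵ
  ; C6            = C6ᴵ
  ; C7            = C7ᴵ
  ; C8            = C8ᴵ
  }

{-# OPTIONS --safe #-}

-- Write h x = ¬κ¬x, which behaves like x/2. Halves are unique in a continuous
-- algebra A, so mean x y = h x ⊕ h y is a commutative, medial and cancellative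
-- midpoint operation, and the direct limit of A along x ↦ mean x ½ is a
-- 2-divisible lattice-ordered abelian group G of which A is the unit interval
-- [0,u]. In G every term τ is a join of meets of affine functions of the
-- variables, with natural denominators, and so is − σ; hence τ ≤ σ reduces to
-- inequalities f₁ ∧ … ∧ fₖ ≤ 0 between affine functions. If such an inequality
-- holds at all rational points, Fourier–Motzkin elimination yields weights
-- wᵢ ≥ 0, not all zero, with Σ wᵢ fᵢ ≤ 0; therefore (Σ wᵢ)(f₁ ∧ … ∧ fₖ) ≤ 0 in
-- G, and G is unperforated. Validity at rational points follows from validity
-- in [0,1], so the argument is constructive and needs no prime ideals.
module Submission where

open import Defs
open import Data.Nat using (ℕ)
open import Function.Bundles using (_⇔_)
open import Level using (Level)

open import Algebra.Bundles using (AbelianGroup)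
open import Data.Empty using (⊥; ⊥-elim)
open import Data.Fin using (Fin; zero; suc)
open import Data.List using (List; []; _∷_; map; concat; cartesianProductWith)
open import Data.List.Membership.Propositional using (_∈_; find)
open import Data.List.Membership.Propositional.Properties using (∈-cartesianProductWith⁺; ∈-map⁺; ∈-map⁻)
open import Data.List.Relation.Unary.All as All using (All; []; _∷_)
import Data.List.Relation.Unary.All.Properties as Allₚ
open import Data.List.Relation.Unary.Any as Any using (Any; here; there)
import Data.List.Relation.Unary.Any.Properties as Anyₚ
open import Data.Nat as ℕ using (zero; suc)
import Data.Nat.Properties as ℕₚ
open import Data.Nat.Solver using (module +-*-Solver)
open import Data.Product using (_×_; _,_; proj₁; proj₂; swap; ∃-syntax)
open import Data.Sum using (_⊎_; inj₁; inj₂)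
open import Data.Unit using (⊤; tt)
open import Data.Vec.Functional as Vector using (Vector)
open import Function using (_∘_; mk⇔)
open import Level using (0ℓ; Lift; lift; lower) renaming (suc to lsuc; _⊔_ to _⊔ˡ_)
open import Relation.Binary.Bundles using (Poset; Setoid)
open import Relation.Binary.Core using (Rel)
open import Relation.Binary.PropositionalEquality as ≡ using (_≡_)
open import Relation.Binary.Structures using (IsEquivalence; IsPreorder)
open import Relation.Nullary using (yes; no)

-- Halves and means in continuous algebras

-- Truncation makes `_⊕_` non-cancellative, so no group can be read off from it directly. Means
-- never leave the unit interval, hence lose nothing, and the group is built from them alone. Its
-- zero is `½̄`, because `mean x (¬ x)` is always `½̄`. Each side proves only one half of a normal
-- form: in the group a term lies below its join of meets, over the rationals it lies above. These
-- are the two halves that an inequality between terms needs. Negatives get a normal form of their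
-- own because negating a join of meets would give a meet of joins. Elimination is done over the
-- rationals because their order is dense and decidable: density supplies a point satisfying a
-- strict system, and decidability turns the failure of such a system into a definite bound that is
-- not positive.

module MVArithmetic {c ℓ : Level} (A : ContinuousAlgebra c ℓ) where
  open ContinuousAlgebra A public
  open IsEquivalence isEquivalence public using (refl; sym; trans)

  private
    setoid : Setoid c ℓ
    setoid = record { isEquivalence = isEquivalence }
  open import Relation.Binary.Reasoning.Setoid setoid

  infix 4 _≤_
  infixl 6 _⊖_ _∨_ _∧_

  1̄ : Carrier
  1̄ = ¬ 0̄

  _≤_ : Carrier → Carrier → Set ℓ
  x ≤ y = ¬ x ⊕ y ≈ 1̄

  -- C1-C6 are the axioms of an MV-algebra: `_⊖_` is truncated subtraction, and C6 is commutativity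
  -- of `_∨_`.
  _⊖_ _∨_ _∧_ : Carrier → Carrier → Carrier
  x ⊖ y = ¬ (¬ x ⊕ y)
  x ∨ y = (x ⊖ y) ⊕ y
  x ∧ y = ¬ (¬ x ∨ ¬ y)

  ⊕-congˡ : ∀ {x y z} → y ≈ z → x ⊕ y ≈ x ⊕ z
  ⊕-congˡ = ⊕-cong refl

  ⊕-congʳ : ∀ {x y z} → y ≈ z → y ⊕ x ≈ z ⊕ x
  ⊕-congʳ p = ⊕-cong p refl

  ⊖-cong : ∀ {x y z w} → x ≈ y → z ≈ w → x ⊖ z ≈ y ⊖ w
  ⊖-cong p q = ¬-cong (⊕-cong (¬-cong p) q)

  ¬1≈0 : ¬ 1̄ ≈ 0̄
  ¬1≈0 = C4 0̄

  ⊕-identityˡ : ∀ x → 0̄ ⊕ x ≈ x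
  ⊕-identityˡ x = trans (C2 0̄ x) (C3 x)

  ⊕-zeroˡ : ∀ x → 1̄ ⊕ x ≈ 1̄
  ⊕-zeroˡ x = trans (C2 1̄ x) (C5 x)

  ⊕-interchange : ∀ a b x y → (a ⊕ b) ⊕ (x ⊕ y) ≈ (a ⊕ x) ⊕ (b ⊕ y)
  ⊕-interchange a b x y = begin
    (a ⊕ b) ⊕ (x ⊕ y)  ≈⟨ C1 (a ⊕ b) x y ⟩
    (a ⊕ b) ⊕ x ⊕ y    ≈⟨ ⊕-congʳ (sym (C1 a b x)) ⟩
    a ⊕ (b ⊕ x) ⊕ y    ≈⟨ ⊕-congʳ (⊕-congˡ (C2 b x)) ⟩
    a ⊕ (x ⊕ b) ⊕ y    ≈⟨ ⊕-congʳ (C1 a x b) ⟩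
    (a ⊕ x) ⊕ b ⊕ y    ≈⟨ C1 (a ⊕ x) b y ⟨
    (a ⊕ x) ⊕ (b ⊕ y)  ∎

  ¬x⊕x≈1 : ∀ x → ¬ x ⊕ x ≈ 1̄
  ¬x⊕x≈1 x = begin
    ¬ x ⊕ x            ≈⟨ ⊕-congʳ (¬-cong (trans (⊕-congʳ ¬1≈0) (⊕-identityˡ x))) ⟨
    ¬ (¬ 1̄ ⊕ x) ⊕ x    ≈⟨ C6 x 1̄ ⟨
    ¬ (¬ x ⊕ 1̄) ⊕ 1̄    ≈⟨ C5 _ ⟩
    1̄                  ∎

  x≤x⊕y : ∀ x y → x ≤ x ⊕ y
  x≤x⊕y x y = trans (C1 _ x y) (trans (⊕-congʳ (¬x⊕x≈1 x)) (⊕-zeroˡ y))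

  ≤-respʳ : ∀ {x y z} → y ≈ z → x ≤ y → x ≤ z
  ≤-respʳ y≈z p = trans (⊕-congˡ (sym y≈z)) p

  ≤-respˡ : ∀ {x y z} → y ≈ z → y ≤ x → z ≤ x
  ≤-respˡ y≈z p = trans (⊕-congʳ (¬-cong (sym y≈z))) p

  x≤y⊕x : ∀ x y → x ≤ y ⊕ x
  x≤y⊕x x y = ≤-respʳ (C2 x y) (x≤x⊕y x y)

  ⊖-zero : ∀ {x y} → x ≤ y → x ⊖ y ≈ 0̄
  ⊖-zero p = trans (¬-cong p) ¬1≈0

  x≤y⇒y⊖x⊕x≈y : ∀ {x y} → x ≤ y → (y ⊖ x) ⊕ x ≈ y
  x≤y⇒y⊖x⊕x≈y {x} {y} p = trans (C6 y x) (trans (⊕-congʳ (⊖-zero p)) (⊕-identityˡ y))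

  ≤-reflexive : ∀ {x y} → x ≈ y → x ≤ y
  ≤-reflexive {x} p = ≤-respʳ p (¬x⊕x≈1 x)

  ≤-refl : ∀ {x} → x ≤ x
  ≤-refl = ≤-reflexive refl

  ≤-trans : ∀ {x y z} → x ≤ y → y ≤ z → x ≤ z
  ≤-trans {x} {y} {z} p q = ≤-respʳ eq (x≤y⊕x x ((z ⊖ y) ⊕ (y ⊖ x)))
    where
    eq : (z ⊖ y) ⊕ (y ⊖ x) ⊕ x ≈ z
    eq = trans (sym (C1 _ _ _)) (trans (⊕-congˡ (x≤y⇒y⊖x⊕x≈y p)) (x≤y⇒y⊖x⊕x≈y q))

  ≤-antisym : ∀ {x y} → x ≤ y → y ≤ x → x ≈ y
  ≤-antisym {x} {y} p q = begin
    x            ≈⟨ ⊕-identityˡ x ⟨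
    0̄ ⊕ x        ≈⟨ ⊕-congʳ (⊖-zero q) ⟨
    (y ⊖ x) ⊕ x  ≈⟨ x≤y⇒y⊖x⊕x≈y p ⟩
    y            ∎

  poset : Poset c ℓ ℓ
  poset = record
    { Carrier = Carrier ; _≈_ = _≈_ ; _≤_ = _≤_
    ; isPartialOrder = record
      { isPreorder = record { isEquivalence = isEquivalence ; reflexive = ≤-reflexive ; trans = ≤-trans }
      ; antisym = ≤-antisym
      }
    }

  x≤1 : ∀ x → x ≤ 1̄
  x≤1 x = C5 _

  ⊕-monoˡ-≤ : ∀ z {x y} → x ≤ y → x ⊕ z ≤ y ⊕ z
  ⊕-monoˡ-≤ z {x} {y} p = ≤-respʳ
    (trans (C1 (y ⊖ x) x z) (⊕-congʳ (x≤y⇒y⊖x⊕x≈y p))) (x≤y⊕x (x ⊕ z) (y ⊖ x))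

  ⊕-mono-≤ : ∀ {x y z w} → x ≤ y → z ≤ w → x ⊕ z ≤ y ⊕ w
  ⊕-mono-≤ {x} {y} {z} {w} p q = ≤-trans (⊕-monoˡ-≤ z p)
    (≤-respˡ (C2 z y) (≤-respʳ (C2 w y) (⊕-monoˡ-≤ y q)))

  ¬-anti-≤ : ∀ {x y} → x ≤ y → ¬ y ≤ ¬ x
  ¬-anti-≤ {x} {y} p = trans (⊕-congʳ (C4 y)) (trans (C2 y (¬ x)) p)

  x≤¬y⇒y≤¬x : ∀ {x y} → x ≤ ¬ y → y ≤ ¬ x
  x≤¬y⇒y≤¬x {x} {y} p = ≤-respˡ (C4 y) (¬-anti-≤ p)

  ⊖-adjointˡ : ∀ {x y z} → x ≤ z ⊕ y → x ⊖ y ≤ z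
  ⊖-adjointˡ {x} {y} {z} p =
    trans (⊕-congʳ (C4 _)) (trans (sym (C1 (¬ x) y z)) (trans (⊕-congˡ (C2 y z)) p))

  ⊖-adjointʳ : ∀ {x y z} → x ⊖ y ≤ z → x ≤ z ⊕ y
  ⊖-adjointʳ {x} {y} {z} p =
    trans (⊕-congˡ (C2 z y)) (trans (C1 (¬ x) y z) (trans (⊕-congʳ (sym (C4 _))) p))

  ⊖-monoˡ-≤ : ∀ z {x y} → x ≤ y → x ⊖ z ≤ y ⊖ z
  ⊖-monoˡ-≤ z p = ⊖-adjointˡ (≤-trans p (⊖-adjointʳ ≤-refl))

  x≤x∨y : ∀ x y → x ≤ x ∨ y
  x≤x∨y x y = ⊖-adjointʳ ≤-refl

  y≤x∨y : ∀ x y → y ≤ x ∨ y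
  y≤x∨y x y = x≤y⊕x y (x ⊖ y)

  ∨-lub : ∀ {x y z} → x ≤ z → y ≤ z → x ∨ y ≤ z
  ∨-lub {x} {y} p q = ≤-respʳ (x≤y⇒y⊖x⊕x≈y q) (⊕-monoˡ-≤ y (⊖-monoˡ-≤ y p))

  x∧y≤x : ∀ x y → x ∧ y ≤ x
  x∧y≤x x y = ≤-respʳ (C4 x) (¬-anti-≤ (x≤x∨y (¬ x) (¬ y)))

  x∧y≤y : ∀ x y → x ∧ y ≤ y
  x∧y≤y x y = ≤-respʳ (C4 y) (¬-anti-≤ (y≤x∨y (¬ x) (¬ y)))

  ∧-glb : ∀ {x y z} → z ≤ x → z ≤ y → z ≤ x ∧ y
  ∧-glb {x} {y} {z} p q = x≤¬y⇒y≤¬x (∨-lub (¬-anti-≤ p) (¬-anti-≤ q))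

  -- The condition `x ≤ ¬ y` says that the sum is not truncated. After complementing, the claim is
  -- `(¬ x ⊖ y) ⊕ y ≈ ¬ x`, which holds because `y ≤ ¬ x`.
  x⊕y⊖y≈x : ∀ {x y} → x ≤ ¬ y → (x ⊕ y) ⊖ y ≈ x
  x⊕y⊖y≈x {x} {y} p = begin
    ¬ (¬ (x ⊕ y) ⊕ y)        ≈⟨ ¬-cong (⊕-congʳ (¬-cong (⊕-congʳ (C4 x)))) ⟨
    ¬ ((¬ x ⊖ y) ⊕ y)        ≈⟨ ¬-cong (x≤y⇒y⊖x⊕x≈y (x≤¬y⇒y≤¬x p)) ⟩
    ¬ ¬ x                    ≈⟨ C4 x ⟩
    x                        ∎

  ⊕-cancelʳ-≤ : ∀ {x y z} → x ≤ ¬ z → x ⊕ z ≤ y ⊕ z → x ≤ y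
  ⊕-cancelʳ-≤ p q = ≤-respˡ (x⊕y⊖y≈x p) (⊖-adjointˡ q)

  h : Carrier → Carrier
  h x = ¬ (κ (¬ x))

  ½̄ : Carrier
  ½̄ = h 1̄

  h-cong : ∀ {x y} → x ≈ y → h x ≈ h y
  h-cong p = ¬-cong (κ-cong (¬-cong p))

  ¬hx≈¬x⊕hx : ∀ x → ¬ (h x) ≈ ¬ x ⊕ h x
  ¬hx≈¬x⊕hx x = trans (C4 _) (C7 (¬ x))

  h≤ : ∀ x → h x ≤ x
  h≤ x = trans (⊕-congʳ (trans (¬hx≈¬x⊕hx x) (C2 _ _)))
    (trans (sym (C1 _ _ _)) (trans (⊕-congˡ (¬x⊕x≈1 x)) (C5 _)))

  -- C7 at `¬ x` amounts to `h x ≈ x ⊖ h x`; adding `h x` back gives `x`.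
  h⊕h : ∀ x → h x ⊕ h x ≈ x
  h⊕h x = begin
    h x ⊕ h x        ≈⟨ ⊕-congʳ (C4 (h x)) ⟨
    ¬ ¬ (h x) ⊕ h x  ≈⟨ ⊕-congʳ (¬-cong (¬hx≈¬x⊕hx x)) ⟩
    (x ⊖ h x) ⊕ h x  ≈⟨ x≤y⇒y⊖x⊕x≈y (h≤ x) ⟩
    x                ∎

  ¬½≈½ : ¬ ½̄ ≈ ½̄
  ¬½≈½ = trans (¬hx≈¬x⊕hx 1̄) (trans (⊕-congʳ ¬1≈0) (⊕-identityˡ ½̄))

  -- C8 at `¬ 1̄` and `¬ x`, where the last summand vanishes. The bound keeps the sum of two halves
  -- untruncated, which makes means cancellable.
  h≤½ : ∀ x → h x ≤ ½̄
  h≤½ x = begin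
    ¬ (h x) ⊕ ½̄                              ≈⟨ C2 _ _ ⟩
    ½̄ ⊕ ¬ (h x)                              ≈⟨ ⊕-congˡ (C4 _) ⟩
    ½̄ ⊕ κ (¬ x)                              ≈⟨ C3 _ ⟨
    ½̄ ⊕ κ (¬ x) ⊕ 0̄                          ≈⟨ ⊕-congˡ (trans (¬-cong (trans (⊕-congʳ (C4 1̄)) (⊕-zeroˡ _))) ¬1≈0) ⟨
    ½̄ ⊕ κ (¬ x) ⊕ ¬ (¬ ¬ 1̄ ⊕ ¬ x)            ≈⟨ C8 (¬ 1̄) (¬ x) ⟩
    1̄                                        ∎

  ≤½⇒≤¬ : ∀ {x y} → x ≤ ½̄ → y ≤ ½̄ → x ≤ ¬ y
  ≤½⇒≤¬ p q = ≤-trans p (≤-respˡ ¬½≈½ (¬-anti-≤ q))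

  -- With s = x ∨ y, distributing gives s + x = 2x ∨ (x + y) ≤ 2y ∨ (x + y) = s + y; cancel s.
  double-cancel-≤ : ∀ {x y} → x ≤ ½̄ → y ≤ ½̄ → x ⊕ x ≤ y ⊕ y → x ≤ y
  double-cancel-≤ {x} {y} x≤½ y≤½ 2x≤2y = ⊕-cancelʳ-≤ (≤½⇒≤¬ x≤½ s≤½) x⊕s≤y⊕s
    where
    s t : Carrier
    s = x ∨ y
    t = y ⊕ s
    s≤½ : s ≤ ½̄
    s≤½ = ∨-lub x≤½ y≤½
    residual : ∀ {z} → z ≤ ½̄ → z ⊕ x ≤ t → z ≤ t ⊖ x
    residual p q = ≤-respˡ (x⊕y⊖y≈x (≤½⇒≤¬ p x≤½)) (⊖-monoˡ-≤ x q)
    s≤t⊖x : s ≤ t ⊖ x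
    s≤t⊖x = ∨-lub (residual x≤½ (≤-trans 2x≤2y (⊕-mono-≤ ≤-refl (y≤x∨y x y))))
                  (residual y≤½ (⊕-mono-≤ ≤-refl (x≤x∨y x y)))
    x⊕s≤y⊕s : x ⊕ s ≤ y ⊕ s
    x⊕s≤y⊕s = ≤-respˡ (C2 s x) (≤-respʳ
      (x≤y⇒y⊖x⊕x≈y (≤-trans (x≤x∨y x y) (x≤y⊕x s y))) (⊕-monoˡ-≤ x s≤t⊖x))

  -- Doubling is injective below `½̄`. Identities for `h` thus reduce to exhibiting an element below
  -- `½̄` with the right double.
  half-unique : ∀ {x y} → x ≤ ½̄ → x ⊕ x ≈ y → x ≈ h y
  half-unique {x} {y} p q = ≤-antisym
    (double-cancel-≤ p (h≤½ y) (≤-reflexive (trans q (sym (h⊕h y)))))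
    (double-cancel-≤ (h≤½ y) p (≤-reflexive (trans (h⊕h y) (sym q))))

  ≤h : ∀ {x y} → x ≤ ½̄ → x ⊕ x ≤ y → x ≤ h y
  ≤h {x} {y} p q = double-cancel-≤ p (h≤½ y) (≤-respʳ (sym (h⊕h y)) q)

  h-mono-≤ : ∀ {x y} → x ≤ y → h x ≤ h y
  h-mono-≤ {x} p = ≤h (h≤½ x) (≤-respˡ (sym (h⊕h x)) p)

  h-cancel-≤ : ∀ {x y} → h x ≤ h y → x ≤ y
  h-cancel-≤ {x} {y} p = ≤-respˡ (h⊕h x) (≤-respʳ (h⊕h y) (⊕-mono-≤ p p))

  h0≈0 : h 0̄ ≈ 0̄
  h0≈0 = ≤-antisym (h≤ 0̄) (≤-respʳ (⊕-identityˡ _) (x≤x⊕y 0̄ (h 0̄)))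

  h≤¬h : ∀ x y → h x ≤ ¬ (h y)
  h≤¬h x y = ≤½⇒≤¬ (h≤½ x) (h≤½ y)

  mean : Carrier → Carrier → Carrier
  mean x y = h x ⊕ h y

  mean-cong : ∀ {x y z w} → x ≈ y → z ≈ w → mean x z ≈ mean y w
  mean-cong p q = ⊕-cong (h-cong p) (h-cong q)

  mean-comm : ∀ x y → mean x y ≈ mean y x
  mean-comm x y = C2 _ _

  mean-idem : ∀ x → mean x x ≈ x
  mean-idem = h⊕h

  mean-0 : ∀ x → mean x 0̄ ≈ h x
  mean-0 x = trans (⊕-congˡ h0≈0) (C3 _)

  mean-monoˡ-≤ : ∀ z {x y} → x ≤ y → mean x z ≤ mean y z
  mean-monoˡ-≤ z p = ⊕-monoˡ-≤ (h z) (h-mono-≤ p)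

  mean-cancelʳ-≤ : ∀ z {x y} → mean x z ≤ mean y z → x ≤ y
  mean-cancelʳ-≤ z {x} p = h-cancel-≤ (⊕-cancelʳ-≤ (h≤¬h x z) p)

  h-mean : ∀ x y → h (mean x y) ≈ mean (h x) (h y)
  h-mean x y = sym (half-unique
    (≤-respʳ (h⊕h ½̄) (⊕-mono-≤ (h-mono-≤ (h≤½ x)) (h-mono-≤ (h≤½ y))))
    (trans (⊕-interchange _ _ _ _) (⊕-cong (h⊕h (h x)) (h⊕h (h y)))))

  mean-medial : ∀ a b x y → mean (mean a b) (mean x y) ≈ mean (mean a x) (mean b y)
  mean-medial a b x y = begin
    mean (mean a b) (mean x y)                     ≈⟨ ⊕-cong (h-mean a b) (h-mean x y) ⟩
    mean (h a) (h b) ⊕ mean (h x) (h y)            ≈⟨ ⊕-interchange _ _ _ _ ⟩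
    mean (h a) (h x) ⊕ mean (h b) (h y)            ≈⟨ ⊕-cong (h-mean a x) (h-mean b y) ⟨
    mean (mean a x) (mean b y)                     ∎

  -- Put b = ½ - x/2. Then b + b + x/2 = b + ½ = 1 - x/2, and removing x/2 leaves b + b = 1 - x;
  -- `b⊕b≤¬hx` makes the removal exact.
  h¬≈½⊖h : ∀ x → h (¬ x) ≈ ½̄ ⊖ h x
  h¬≈½⊖h x = sym (half-unique b≤½ (begin
      b ⊕ b                      ≈⟨ x⊕y⊖y≈x b⊕b≤¬hx ⟨
      (b ⊕ b ⊕ h x) ⊖ h x        ≈⟨ ⊖-cong b⊕b⊕hx refl ⟩
      ¬ (h x) ⊖ h x              ≈⟨ ¬-cong (⊕-congʳ (C4 _)) ⟩
      ¬ (h x ⊕ h x)              ≈⟨ ¬-cong (h⊕h x) ⟩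
      ¬ x                        ∎))
    where
    b : Carrier
    b = ½̄ ⊖ h x
    b≤½ : b ≤ ½̄
    b≤½ = ⊖-adjointˡ (x≤x⊕y _ _)
    b⊕hx : b ⊕ h x ≈ ½̄
    b⊕hx = x≤y⇒y⊖x⊕x≈y (h≤½ x)
    b⊕½ : b ⊕ ½̄ ≈ ¬ (h x)
    b⊕½ = begin
      b ⊕ ½̄                ≈⟨ C4 _ ⟨
      ¬ ¬ (b ⊕ ½̄)          ≈⟨ ¬-cong (¬-cong (C2 b ½̄)) ⟩
      ¬ ¬ (½̄ ⊕ b)          ≈⟨ ¬-cong (¬-cong (⊕-congʳ (sym ¬½≈½))) ⟩
      ¬ (½̄ ⊖ b)            ≈⟨ ¬-cong (⊖-cong (trans (sym b⊕hx) (C2 _ _)) refl) ⟩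
      ¬ ((h x ⊕ b) ⊖ b)    ≈⟨ ¬-cong (x⊕y⊖y≈x (≤½⇒≤¬ (h≤½ x) b≤½)) ⟩
      ¬ (h x)              ∎
    b⊕b≤¬hx : b ⊕ b ≤ ¬ (h x)
    b⊕b≤¬hx = ≤-respʳ b⊕½ (⊕-mono-≤ ≤-refl b≤½)
    b⊕b⊕hx : b ⊕ b ⊕ h x ≈ ¬ (h x)
    b⊕b⊕hx = trans (sym (C1 _ _ _)) (trans (⊕-congˡ b⊕hx) b⊕½)

  mean-¬ : ∀ x → mean x (¬ x) ≈ ½̄
  mean-¬ x = begin
    h x ⊕ h (¬ x)      ≈⟨ C2 _ _ ⟩
    h (¬ x) ⊕ h x      ≈⟨ ⊕-congʳ (h¬≈½⊖h x) ⟩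
    (½̄ ⊖ h x) ⊕ h x    ≈⟨ x≤y⇒y⊖x⊕x≈y (h≤½ x) ⟩
    ½̄                  ∎

  -- By cancellation: both sides have mean `½̄` with `mean x y`, the right one by the medial law.
  ¬-mean : ∀ x y → ¬ (mean x y) ≈ mean (¬ x) (¬ y)
  ¬-mean x y = ≤-antisym
    (mean-cancelʳ-≤ (mean x y) (≤-reflexive eq))
    (mean-cancelʳ-≤ (mean x y) (≤-reflexive (sym eq)))
    where
    eq : mean (¬ (mean x y)) (mean x y) ≈ mean (mean (¬ x) (¬ y)) (mean x y)
    eq = begin
      mean (¬ (mean x y)) (mean x y)            ≈⟨ mean-comm _ _ ⟩
      mean (mean x y) (¬ (mean x y))            ≈⟨ mean-¬ (mean x y) ⟩
      ½̄                                         ≈⟨ mean-idem ½̄ ⟨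
      mean ½̄ ½̄                                  ≈⟨ mean-cong (mean-¬ x) (mean-¬ y) ⟨
      mean (mean x (¬ x)) (mean y (¬ y))        ≈⟨ mean-medial _ _ _ _ ⟩
      mean (mean x y) (mean (¬ x) (¬ y))        ≈⟨ mean-comm _ _ ⟩
      mean (mean (¬ x) (¬ y)) (mean x y)        ∎

  -- The remainder `w ⊖ h z` lies below `h x` and `h y`, so its double lies below `x ∧ y`; halve
  -- again and add `h z` back.
  ≤mean-∧ : ∀ {w x y z} → w ≤ mean x z → w ≤ mean y z → w ≤ mean (x ∧ y) z
  ≤mean-∧ {w} {x} {y} {z} p q = ⊖-adjointʳ (≤h (≤-trans (⊖-adjointˡ p) (h≤½ x))
    (∧-glb (doubled (⊖-adjointˡ p)) (doubled (⊖-adjointˡ q))))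
    where
    doubled : ∀ {a b} → a ≤ h b → a ⊕ a ≤ b
    doubled {a} {b} r = ≤-respʳ (h⊕h b) (⊕-mono-≤ r r)

  -- For d = h (x ⊕ y) ⊖ h y one has d + d + y = x ⊕ y, a sum that is untruncated because d + d ≤ ¬
  -- y. Hence d + d = (x ⊕ y) ⊖ y ≤ x, that is, d ≤ h x.
  h-⊕-≤-mean : ∀ x y → h (x ⊕ y) ≤ mean x y
  h-⊕-≤-mean x y = ⊖-adjointʳ (≤h d≤½ (≤-respˡ 2d (⊖-adjointˡ ≤-refl)))
    where
    d : Carrier
    d = h (x ⊕ y) ⊖ h y
    d≤½ : d ≤ ½̄
    d≤½ = ⊖-adjointˡ (≤-trans (h≤½ _) (x≤x⊕y _ _))
    d⊕hy : d ⊕ h y ≈ h (x ⊕ y)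
    d⊕hy = x≤y⇒y⊖x⊕x≈y (h-mono-≤ (x≤y⊕x y x))
    d≤h¬y : d ≤ h (¬ y)
    d≤h¬y = ≤-respʳ (sym (h¬≈½⊖h y)) (⊖-monoˡ-≤ (h y) (h≤½ _))
    d⊕d≤¬y : d ⊕ d ≤ ¬ y
    d⊕d≤¬y = ≤-respʳ (h⊕h (¬ y)) (⊕-mono-≤ d≤h¬y d≤h¬y)
    d⊕d⊕y : d ⊕ d ⊕ y ≈ x ⊕ y
    d⊕d⊕y = begin
      d ⊕ d ⊕ y                  ≈⟨ ⊕-congˡ (h⊕h y) ⟨
      d ⊕ d ⊕ (h y ⊕ h y)        ≈⟨ ⊕-interchange _ _ _ _ ⟩
      d ⊕ h y ⊕ (d ⊕ h y)        ≈⟨ ⊕-cong d⊕hy d⊕hy ⟩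
      h (x ⊕ y) ⊕ h (x ⊕ y)      ≈⟨ h⊕h _ ⟩
      x ⊕ y                      ∎
    2d : (x ⊕ y) ⊖ y ≈ d ⊕ d
    2d = trans (⊖-cong (sym d⊕d⊕y) refl) (x⊕y⊖y≈x d⊕d≤¬y)

  -- Halving turns truncation at 1 into a meet with `½̄`. This lets `ι-⊕` express `_⊕_` through the
  -- sum and the meet of the group.
  h-⊕ : ∀ x y → h (x ⊕ y) ≈ mean x y ∧ ½̄
  h-⊕ x y = ≤-antisym (∧-glb (h-⊕-≤-mean x y) (h≤½ _))
    (≤h (x∧y≤y _ _) (≤-respʳ eq (⊕-mono-≤ (x∧y≤x _ _) (x∧y≤x _ _))))
    where
    eq : mean x y ⊕ mean x y ≈ x ⊕ y
    eq = trans (⊕-interchange _ _ _ _) (⊕-cong (h⊕h x) (h⊕h y))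

-- The enveloping lattice-ordered group

record OrderedGroup (c ℓ₁ ℓ₂ : Level) : Set (lsuc (c ⊔ˡ ℓ₁ ⊔ˡ ℓ₂)) where
  infix 4 _≤_
  field
    abelianGroup : AbelianGroup c ℓ₁
  open AbelianGroup abelianGroup public
    renaming
    ( _∙_ to infixl 6 _+_; ε to 0#; _⁻¹ to infix 8 -_
    ; ∙-cong to +-cong; ∙-congˡ to +-congˡ; ∙-congʳ to +-congʳ; assoc to +-assoc; comm to +-comm
    ; identityˡ to +-identityˡ; identityʳ to +-identityʳ; inverseˡ to -‿inverseˡ; inverseʳ to -‿inverseʳ
    ; reflexive to ≈-reflexive
    )
    hiding (_-_)
  field
    _≤_        : Rel Carrier ℓ₂
    isPreorder : IsPreorder _≈_ _≤_
    +-monoˡ-≤  : ∀ z {x y} → x ≤ y → x + z ≤ y + z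

record LatticeGroup (c ℓ₁ ℓ₂ : Level) : Set (lsuc (c ⊔ˡ ℓ₁ ⊔ˡ ℓ₂)) where
  infixl 7 _∧_
  field
    orderedGroup : OrderedGroup c ℓ₁ ℓ₂
  open OrderedGroup orderedGroup public
  field
    _∧_       : Carrier → Carrier → Carrier
    x∧y≤x     : ∀ x y → x ∧ y ≤ x
    x∧y≤y     : ∀ x y → x ∧ y ≤ y
    ∧-glb     : ∀ {x y z} → z ≤ x → z ≤ y → z ≤ x ∧ y
    half      : Carrier → Carrier
    half+half : ∀ x → half x + half x ≈ x

module Envelope {c ℓ : Level} (A : ContinuousAlgebra c ℓ) where
  open MVArithmetic A
  open import Relation.Binary.Reasoning.PartialOrder poset

  ≡⇒≈ : ∀ {x y : Carrier} → x ≡ y → x ≈ y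
  ≡⇒≈ ≡.refl = refl

  -- On the centred value 2x - 1 each step is division by 2, so `raise k` rewrites an element `k`
  -- levels further along the direct limit.
  raise : ℕ → Carrier → Carrier
  raise zero    x = x
  raise (suc k) x = mean (raise k x) ½̄

  raise-+ : ∀ k l x → raise (k ℕ.+ l) x ≡ raise k (raise l x)
  raise-+ zero    l x = ≡.refl
  raise-+ (suc k) l x = ≡.cong (λ y → mean y ½̄) (raise-+ k l x)

  raise-≡ : ∀ k l m n {x} → k ℕ.+ l ≡ m ℕ.+ n → raise k (raise l x) ≡ raise m (raise n x)
  raise-≡ k l m n {x} eq =
    ≡.trans (≡.sym (raise-+ k l x)) (≡.trans (≡.cong (λ i → raise i x) eq) (raise-+ m n x))

  raise-comm : ∀ k l x → raise k (raise l x) ≡ raise l (raise k x)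
  raise-comm k l x = raise-≡ k l l k (ℕₚ.+-comm k l)

  raise-cong : ∀ k {x y} → x ≈ y → raise k x ≈ raise k y
  raise-cong zero    p = p
  raise-cong (suc k) p = mean-cong (raise-cong k p) refl

  raise-mono-≤ : ∀ k {x y} → x ≤ y → raise k x ≤ raise k y
  raise-mono-≤ zero    p = p
  raise-mono-≤ (suc k) p = mean-monoˡ-≤ ½̄ (raise-mono-≤ k p)

  raise-cancel-≤ : ∀ k {x y} → raise k x ≤ raise k y → x ≤ y
  raise-cancel-≤ zero    p = p
  raise-cancel-≤ (suc k) p = raise-cancel-≤ k (mean-cancelʳ-≤ ½̄ p)

  raise-½ : ∀ k → raise k ½̄ ≈ ½̄
  raise-½ zero    = refl
  raise-½ (suc k) = trans (mean-cong (raise-½ k) refl) (mean-idem ½̄)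

  raise-mean : ∀ k x y → raise k (mean x y) ≈ mean (raise k x) (raise k y)
  raise-mean zero    x y = refl
  raise-mean (suc k) x y = begin-equality
    mean (raise k (mean x y)) ½̄                    ≈⟨ mean-cong (raise-mean k x y) (sym (mean-idem ½̄)) ⟩
    mean (mean (raise k x) (raise k y)) (mean ½̄ ½̄)  ≈⟨ mean-medial _ _ _ _ ⟩
    mean (raise (suc k) x) (raise (suc k) y)       ∎

  raise-¬ : ∀ k x → raise k (¬ x) ≈ ¬ (raise k x)
  raise-¬ zero    x = refl
  raise-¬ (suc k) x = trans (mean-cong (raise-¬ k x) (sym ¬½≈½)) (sym (¬-mean _ _))

  ≤raise-∧ : ∀ k {w x y} → w ≤ raise k x → w ≤ raise k y → w ≤ raise k (x ∧ y)
  ≤raise-∧ zero    p q = ∧-glb p q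
  ≤raise-∧ (suc k) p q = ≤-trans (≤mean-∧ p q)
    (mean-monoˡ-≤ ½̄ (≤raise-∧ k (x∧y≤x _ _) (x∧y≤y _ _)))

  -- If x ∈ [0,1], the pair (k , x) stands for 2ᵏ(2x − 1).
  G : Set c
  G = ℕ × Carrier

  infix  4 _≤ᴳ_ _≈ᴳ_
  infixl 6 _+ᴳ_
  infixl 7 _∧ᴳ_

  record _≤ᴳ_ (p q : G) : Set ℓ where
    constructor mk≤ᴳ
    field raised : raise (proj₁ q) (proj₂ p) ≤ raise (proj₁ p) (proj₂ q)

  _≈ᴳ_ : G → G → Set ℓ
  p ≈ᴳ q = (p ≤ᴳ q) × (q ≤ᴳ p)

  -- Both arguments are first brought to level `k + l`. A mean is only half a sum; the extra `suc`
  -- restores the factor 2.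
  _+ᴳ_ _∧ᴳ_ : G → G → G
  (k , x) +ᴳ (l , y) = suc (k ℕ.+ l) , mean (raise l x) (raise k y)
  (k , x) ∧ᴳ (l , y) = k ℕ.+ l , raise l x ∧ raise k y

  -ᴳ_ halfᴳ : G → G
  -ᴳ (k , x) = k , ¬ x
  halfᴳ (k , x) = k , mean x ½̄

  0ᴳ 1ᴳ : G
  0ᴳ = 0 , ½̄
  1ᴳ = 0 , 1̄

  -- Since 2 · (x + 1)/2 - 1 = x, the pair stands for `x` itself, just as `1ᴳ` stands for 2 · 1 - 1
  -- = 1.
  ι : Carrier → G
  ι x = 0 , mean x 1̄

  ≈⇒≈ᴳ : ∀ {k l x y} → raise l x ≈ raise k y → (k , x) ≈ᴳ (l , y)
  ≈⇒≈ᴳ p = mk≤ᴳ (≤-reflexive p) , mk≤ᴳ (≤-reflexive (sym p))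

  sameLevel : ∀ {k l x y} → k ≡ l → x ≈ y → (k , x) ≈ᴳ (l , y)
  sameLevel {k} ≡.refl p = ≈⇒≈ᴳ (raise-cong k p)

  ≤ᴳ-trans : ∀ {p q r} → p ≤ᴳ q → q ≤ᴳ r → p ≤ᴳ r
  ≤ᴳ-trans {k , x} {l , y} {m , z} (mk≤ᴳ p) (mk≤ᴳ q) = mk≤ᴳ (raise-cancel-≤ l (begin
    raise l (raise m x)  ≡⟨ raise-comm l m x ⟩
    raise m (raise l x)  ≤⟨ raise-mono-≤ m p ⟩
    raise m (raise k y)  ≡⟨ raise-comm m k y ⟩
    raise k (raise m y)  ≤⟨ raise-mono-≤ k q ⟩
    raise k (raise l z)  ≡⟨ raise-comm k l z ⟩
    raise l (raise k z)  ∎))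

  ≈ᴳ-trans : ∀ {p q r} → p ≈ᴳ q → q ≈ᴳ r → p ≈ᴳ r
  ≈ᴳ-trans (a , b) (a′ , b′) = ≤ᴳ-trans a a′ , ≤ᴳ-trans b′ b

  raise-≈ᴳ : ∀ m {k x} → (m ℕ.+ k , raise m x) ≈ᴳ (k , x)
  raise-≈ᴳ m {k} {x} = ≈⇒≈ᴳ (≡⇒≈ (≡.trans (raise-comm k m x) (≡.sym (raise-+ m k x))))

  open +-*-Solver

  +ᴳ-monoˡ : ∀ r {p q} → p ≤ᴳ q → p +ᴳ r ≤ᴳ q +ᴳ r
  +ᴳ-monoˡ (m , z) {k , x} {l , y} (mk≤ᴳ p) = mk≤ᴳ (begin
    raise (suc (l ℕ.+ m)) (mean (raise m x) (raise k z))
      ≈⟨ raise-mean (suc (l ℕ.+ m)) _ _ ⟩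
    mean (raise (suc (l ℕ.+ m)) (raise m x)) (raise (suc (l ℕ.+ m)) (raise k z))
      ≈⟨ mean-cong
          (≡⇒≈ (raise-≡ (suc (l ℕ.+ m)) m (suc (m ℕ.+ m)) l
            (solve 2 (λ l m → con 1 :+ (l :+ m) :+ m := con 1 :+ (m :+ m) :+ l) ≡.refl l m)))
          (≡⇒≈ (raise-≡ (suc (l ℕ.+ m)) k (suc (k ℕ.+ m)) l
            (solve 3 (λ k l m → con 1 :+ (l :+ m) :+ k := con 1 :+ (k :+ m) :+ l) ≡.refl k l m))) ⟩
    mean (raise (suc (m ℕ.+ m)) (raise l x)) (raise (suc (k ℕ.+ m)) (raise l z))
      ≤⟨ mean-monoˡ-≤ _ (raise-mono-≤ (suc (m ℕ.+ m)) p) ⟩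
    mean (raise (suc (m ℕ.+ m)) (raise k y)) (raise (suc (k ℕ.+ m)) (raise l z))
      ≈⟨ mean-cong
          (≡⇒≈ (raise-≡ (suc (m ℕ.+ m)) k (suc (k ℕ.+ m)) m
            (solve 2 (λ k m → con 1 :+ (m :+ m) :+ k := con 1 :+ (k :+ m) :+ m) ≡.refl k m)))
          refl ⟩
    mean (raise (suc (k ℕ.+ m)) (raise m y)) (raise (suc (k ℕ.+ m)) (raise l z))
      ≈⟨ raise-mean (suc (k ℕ.+ m)) _ _ ⟨
    raise (suc (k ℕ.+ m)) (mean (raise m y) (raise l z))
      ∎)

  +ᴳ-comm : ∀ p q → p +ᴳ q ≈ᴳ q +ᴳ p
  +ᴳ-comm (k , x) (l , y) = sameLevel
    (solve 2 (λ k l → con 1 :+ (k :+ l) := con 1 :+ (l :+ k)) ≡.refl k l) (mean-comm _ _)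

  +ᴳ-assoc : ∀ p q r → (p +ᴳ q) +ᴳ r ≈ᴳ p +ᴳ (q +ᴳ r)
  +ᴳ-assoc (k , x) (l , y) (m , z) = sameLevel
    (solve 3 (λ k l m → con 1 :+ (con 1 :+ (k :+ l) :+ m) := con 1 :+ (k :+ (con 1 :+ (l :+ m)))) ≡.refl k l m)
    (begin-equality
      mean (raise m (mean (raise l x) (raise k y))) (raise (suc (k ℕ.+ l)) z)
        ≈⟨ mean-cong (raise-mean m _ _) refl ⟩
      -- The last level of `raise` is itself a mean with `½̄`; this fourth entry is what the medial
      -- law needs to regroup three summands.
      mean (mean (raise m (raise l x)) (raise m (raise k y))) (mean (raise (k ℕ.+ l) z) ½̄)
        ≈⟨ mean-cong refl (mean-comm _ _) ⟩
      mean (mean (raise m (raise l x)) (raise m (raise k y))) (mean ½̄ (raise (k ℕ.+ l) z))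
        ≈⟨ mean-medial _ _ _ _ ⟩
      mean (mean (raise m (raise l x)) ½̄) (mean (raise m (raise k y)) (raise (k ℕ.+ l) z))
        ≈⟨ mean-cong
            (mean-cong (≡⇒≈ (≡.trans (raise-comm m l x) (≡.sym (raise-+ l m x)))) refl)
            (mean-cong (≡⇒≈ (raise-comm m k y)) (≡⇒≈ (raise-+ k l z))) ⟩
      mean (raise (suc (l ℕ.+ m)) x) (mean (raise k (raise m y)) (raise k (raise l z)))
        ≈⟨ mean-cong refl (raise-mean k _ _) ⟨
      mean (raise (suc (l ℕ.+ m)) x) (raise k (mean (raise m y) (raise l z)))
        ∎)

  +ᴳ-identityʳ : ∀ p → p +ᴳ 0ᴳ ≈ᴳ p
  +ᴳ-identityʳ (k , x) = ≈ᴳ-trans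
    (sameLevel (solve 1 (λ k → con 1 :+ (k :+ con 0) := con 1 :+ k) ≡.refl k) (mean-cong refl (raise-½ k)))
    (raise-≈ᴳ 1)

  +ᴳ-inverseʳ : ∀ p → p +ᴳ (-ᴳ p) ≈ᴳ 0ᴳ
  +ᴳ-inverseʳ (k , x) = ≈⇒≈ᴳ (begin-equality
    mean (raise k x) (raise k (¬ x))  ≈⟨ mean-cong refl (raise-¬ k x) ⟩
    mean (raise k x) (¬ (raise k x))  ≈⟨ mean-¬ _ ⟩
    ½̄                                 ≈⟨ raise-½ (suc (k ℕ.+ k)) ⟨
    raise (suc (k ℕ.+ k)) ½̄           ∎)

  -ᴳ-anti : ∀ {p q} → p ≤ᴳ q → -ᴳ q ≤ᴳ -ᴳ p
  -ᴳ-anti {k , x} {l , y} (mk≤ᴳ p) = mk≤ᴳ (begin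
    raise k (¬ y)    ≈⟨ raise-¬ k y ⟩
    ¬ (raise k y)    ≤⟨ ¬-anti-≤ p ⟩
    ¬ (raise l x)    ≈⟨ raise-¬ l x ⟨
    raise l (¬ x)    ∎)

  halfᴳ+halfᴳ : ∀ p → halfᴳ p +ᴳ halfᴳ p ≈ᴳ p
  halfᴳ+halfᴳ (k , x) = ≈⇒≈ᴳ (begin-equality
    raise k (mean (raise k (raise 1 x)) (raise k (raise 1 x)))
      ≈⟨ raise-cong k (mean-idem _) ⟩
    raise k (raise k (raise 1 x))
      ≡⟨ raise-+ k k (raise 1 x) ⟨
    raise (k ℕ.+ k) (raise 1 x)
      ≡⟨ raise-comm (k ℕ.+ k) 1 x ⟩
    raise (suc (k ℕ.+ k)) x
      ∎)

  ∧ᴳ-glb : ∀ {p q r} → r ≤ᴳ p → r ≤ᴳ q → r ≤ᴳ p ∧ᴳ q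
  ∧ᴳ-glb {k , x} {l , y} {m , z} (mk≤ᴳ p) (mk≤ᴳ q) = mk≤ᴳ (≤raise-∧ m
    (begin
      raise (k ℕ.+ l) z    ≡⟨ ≡.trans (raise-+ k l z) (raise-comm k l z) ⟩
      raise l (raise k z)  ≤⟨ raise-mono-≤ l p ⟩
      raise l (raise m x)  ≡⟨ raise-comm l m x ⟩
      raise m (raise l x)  ∎)
    (begin
      raise (k ℕ.+ l) z    ≡⟨ raise-+ k l z ⟩
      raise k (raise l z)  ≤⟨ raise-mono-≤ k q ⟩
      raise k (raise m y)  ≡⟨ raise-comm k m y ⟩
      raise m (raise k y)  ∎))

  p∧q≤p : ∀ p q → p ∧ᴳ q ≤ᴳ p
  p∧q≤p (k , x) (l , y) = mk≤ᴳ (begin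
    raise k (raise l x ∧ raise k y)  ≤⟨ raise-mono-≤ k (x∧y≤x _ _) ⟩
    raise k (raise l x)              ≡⟨ raise-+ k l x ⟨
    raise (k ℕ.+ l) x                ∎)

  p∧q≤q : ∀ p q → p ∧ᴳ q ≤ᴳ q
  p∧q≤q (k , x) (l , y) = mk≤ᴳ (begin
    raise l (raise l x ∧ raise k y)  ≤⟨ raise-mono-≤ l (x∧y≤y _ _) ⟩
    raise l (raise k y)              ≡⟨ ≡.trans (raise-comm l k y) (≡.sym (raise-+ k l y)) ⟩
    raise (k ℕ.+ l) y                ∎)

  +ᴳ-mono : ∀ {p q r s} → p ≤ᴳ q → r ≤ᴳ s → p +ᴳ r ≤ᴳ q +ᴳ s
  +ᴳ-mono {p} {q} {r} {s} p≤q r≤s = ≤ᴳ-trans (+ᴳ-monoˡ r p≤q)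
    (≤ᴳ-trans (proj₁ (+ᴳ-comm q r)) (≤ᴳ-trans (+ᴳ-monoˡ q r≤s) (proj₁ (+ᴳ-comm s q))))

  abelianGroup : AbelianGroup c ℓ
  abelianGroup = record
    { Carrier = G ; _≈_ = _≈ᴳ_ ; _∙_ = _+ᴳ_ ; ε = 0ᴳ ; _⁻¹ = -ᴳ_
    ; isAbelianGroup = record
      { isGroup = record
        { isMonoid = record
          { isSemigroup = record
            { isMagma = record
              { isEquivalence = record
                { refl  = mk≤ᴳ ≤-refl , mk≤ᴳ ≤-refl
                ; sym   = swap
                ; trans = ≈ᴳ-trans
                }
              ; ∙-cong = λ (a , b) (a′ , b′) → +ᴳ-mono a a′ , +ᴳ-mono b b′
              }
            ; assoc = +ᴳ-assoc
            }
          ; identity =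
              (λ p → ≈ᴳ-trans (+ᴳ-comm 0ᴳ p) (+ᴳ-identityʳ p))
            , +ᴳ-identityʳ
          }
        ; inverse =
            (λ p → ≈ᴳ-trans (+ᴳ-comm (-ᴳ p) p) (+ᴳ-inverseʳ p))
          , +ᴳ-inverseʳ
        ; ⁻¹-cong = λ (a , b) → -ᴳ-anti b , -ᴳ-anti a
        }
      ; comm = +ᴳ-comm
      }
    }

  latticeGroup : LatticeGroup c ℓ ℓ
  latticeGroup = record
    { orderedGroup = record
      { abelianGroup = abelianGroup
      ; _≤_ = _≤ᴳ_
      ; isPreorder = record
        { isEquivalence = AbelianGroup.isEquivalence abelianGroup
        ; reflexive = proj₁
        ; trans = ≤ᴳ-trans
        }
      ; +-monoˡ-≤ = +ᴳ-monoˡ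
      }
    ; _∧_ = _∧ᴳ_
    ; x∧y≤x = p∧q≤p
    ; x∧y≤y = p∧q≤q
    ; ∧-glb = ∧ᴳ-glb
    ; half = halfᴳ
    ; half+half = halfᴳ+halfᴳ
    }

  ι-cancel-≤ : ∀ {x y} → ι x ≤ᴳ ι y → x ≤ y
  ι-cancel-≤ (mk≤ᴳ p) = mean-cancelʳ-≤ 1̄ p

  ι≤1 : ∀ x → ι x ≤ᴳ 1ᴳ
  ι≤1 x = mk≤ᴳ (x≤1 _)

  mean-1-0 : mean 1̄ 0̄ ≈ ½̄
  mean-1-0 = mean-0 1̄

  ι-0 : ι 0̄ ≈ᴳ 0ᴳ
  ι-0 = ≈⇒≈ᴳ (trans (mean-comm _ _) mean-1-0)

  0≤ι : ∀ x → 0ᴳ ≤ᴳ ι x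
  0≤ι x = mk≤ᴳ (≤-respˡ (trans (mean-comm _ _) mean-1-0)
    (mean-monoˡ-≤ 1̄ (≤-respʳ (⊕-identityˡ x) (x≤x⊕y 0̄ x))))

  ¬mean-1 : ∀ x → ¬ (mean x 1̄) ≈ mean (¬ x) 0̄
  ¬mean-1 x = trans (¬-mean x 1̄) (mean-cong refl ¬1≈0)

  ι-¬ : ∀ x → ι (¬ x) ≈ᴳ 1ᴳ +ᴳ (-ᴳ ι x)
  ι-¬ x = ≈⇒≈ᴳ (begin-equality
    mean (mean (¬ x) 1̄) ½̄             ≈⟨ mean-cong (mean-comm _ _) (sym mean-1-0) ⟩
    mean (mean 1̄ (¬ x)) (mean 1̄ 0̄)    ≈⟨ mean-medial _ _ _ _ ⟩
    mean (mean 1̄ 1̄) (mean (¬ x) 0̄)    ≈⟨ mean-cong (mean-idem 1̄) (sym (¬mean-1 x)) ⟩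
    mean 1̄ (¬ (mean x 1̄))             ∎)

  κ≈mean-1 : ∀ x → κ x ≈ mean x 1̄
  κ≈mean-1 x = begin-equality
    κ x              ≈⟨ κ-cong (C4 x) ⟨
    κ (¬ ¬ x)        ≈⟨ C4 _ ⟨
    ¬ (h (¬ x))      ≈⟨ ¬-cong (mean-0 (¬ x)) ⟨
    ¬ (mean (¬ x) 0̄) ≈⟨ ¬-cong (¬mean-1 x) ⟨
    ¬ ¬ (mean x 1̄)   ≈⟨ C4 _ ⟩
    mean x 1̄         ∎

  ι-κ : ∀ x → ι (κ x) +ᴳ ι (κ x) ≈ᴳ ι x +ᴳ 1ᴳ
  ι-κ x = sameLevel ≡.refl (trans (mean-idem _) (mean-cong (κ≈mean-1 x) refl))

  ι-⊕ : ∀ x y → ι (x ⊕ y) ≈ᴳ (ι x +ᴳ ι y) ∧ᴳ 1ᴳ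
  ι-⊕ x y = ≈⇒≈ᴳ (begin-equality
    mean (mean (x ⊕ y) 1̄) ½̄
      ≈⟨ mean-cong refl (trans (sym mean-1-0) (mean-comm _ _)) ⟩
    -- With `½̄` written as a mean of `0̄` and `1̄`, the medial law pairs `x ⊕ y` with `0̄` and
    -- exposes `h (x ⊕ y)`.
    mean (mean (x ⊕ y) 1̄) (mean 0̄ 1̄)
      ≈⟨ mean-medial _ _ _ _ ⟩
    mean (mean (x ⊕ y) 0̄) (mean 1̄ 1̄)
      ≈⟨ mean-cong (trans (mean-0 _) (h-⊕ x y)) (mean-idem 1̄) ⟩
    mean (mean x y ∧ ½̄) 1̄
      ≈⟨ ≤-antisym (∧-glb (mean-monoˡ-≤ 1̄ (x∧y≤x _ _)) (mean-monoˡ-≤ 1̄ (x∧y≤y _ _)))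
                   (≤mean-∧ (x∧y≤x _ _) (x∧y≤y _ _)) ⟩
    mean (mean x y) 1̄ ∧ mean ½̄ 1̄
      ≈⟨ ∧-cong (trans (mean-cong refl (sym (mean-idem 1̄))) (mean-medial _ _ _ _)) (mean-comm _ _) ⟩
    mean (mean x 1̄) (mean y 1̄) ∧ mean 1̄ ½̄
      ∎)
    where
    ∧-cong : ∀ {a b d e} → a ≈ b → d ≈ e → a ∧ d ≈ b ∧ e
    ∧-cong p q = ¬-cong (⊕-cong (⊖-cong (¬-cong p) (¬-cong q)) (¬-cong q))

-- Affine functions and their joins of meets

-- Pairs of naturals p, q play the role of the integer coefficient p − q; the
-- last coefficient belongs to the unit.
data Form : ℕ → Set where
  const : ℕ → ℕ → Form 0
  coeff : ∀ {n} → ℕ → ℕ → Form n → Form (suc n)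

infixl 6 _⊞_
infixr 7 _⊡_

_⊞_ : ∀ {n} → Form n → Form n → Form n
const p q   ⊞ const p′ q′   = const (p ℕ.+ p′) (q ℕ.+ q′)
coeff p q f ⊞ coeff p′ q′ g = coeff (p ℕ.+ p′) (q ℕ.+ q′) (f ⊞ g)

_⊡_ : ∀ {n} → ℕ → Form n → Form n
k ⊡ const p q   = const (k ℕ.* p) (k ℕ.* q)
k ⊡ coeff p q f = coeff (k ℕ.* p) (k ℕ.* q) (k ⊡ f)

unitForm : ∀ {n} → ℕ → ℕ → Form n
unitForm {zero}  p q = const p q
unitForm {suc n} p q = coeff 0 0 (unitForm p q)

varForm : ∀ {n} → Fin n → ℕ → ℕ → Form n
varForm zero    p q = coeff p q (unitForm 0 0)
varForm (suc i) p q = coeff 0 0 (varForm i p q)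

infix 5 _/1+_

-- f /1+ w stands for the affine function f / (w + 1).
record Bound (n : ℕ) : Set where
  constructor _/1+_
  field
    form : Form n
    pred : ℕ

open Bound

-- Cross-multiplication; the successor of the new second component computes to `suc v * suc w`.
_+ᴮ_ : ∀ {n} → Bound n → Bound n → Bound n
(f /1+ w) +ᴮ (g /1+ v) = suc v ⊡ f ⊞ suc w ⊡ g /1+ w ℕ.+ v ℕ.* suc w

halfᴮ : ∀ {n} → Bound n → Bound n
halfᴮ (f /1+ w) = f /1+ suc (w ℕ.* 2)

data Sign : Set where
  none    : Sign
  pos neg : ℕ → Sign

sign : ℕ → ℕ → Sign
sign p q with ℕ.compare p q
... | ℕ.less _ k    = neg k
... | ℕ.equal _     = none
... | ℕ.greater _ k = pos k

-- Weights l + 1 and k + 1 cancel the multiples (k + 1)x and -(l + 1)x. A denominator counts copies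
-- of the element being bounded, so denominators are weighted and added too instead of being
-- multiplied together.
combine : ∀ {n} → ℕ → ℕ → Bound n → Bound n → Bound n
combine k l (f /1+ w) (g /1+ v) = suc l ⊡ f ⊞ suc k ⊡ g /1+ w ℕ.+ l ℕ.* suc w ℕ.+ suc k ℕ.* suc v

-- Elimination runs over all ordered pairs, so opposite signs are combined in one order only. A
-- bound without the variable survives each pairing in which it comes first, including that with
-- itself.
resolveSigned : ∀ {n} → Sign → Sign → Bound n → Bound n → List (Bound n)
resolveSigned none    _       b b′ = b ∷ []
resolveSigned (pos k) (neg l) b b′ = combine k l b b′ ∷ []
resolveSigned (pos _) none    b b′ = []
resolveSigned (pos _) (pos _) b b′ = []
resolveSigned (neg _) _       b b′ = []

resolve : ∀ {n} → Bound (suc n) → Bound (suc n) → List (Bound n)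
resolve (coeff p q f /1+ w) (coeff p′ q′ g /1+ v) = resolveSigned (sign p q) (sign p′ q′) (f /1+ w) (g /1+ v)

-- Fourier–Motzkin elimination of the first variable.
eliminate : ∀ {n} → List (Bound (suc n)) → List (Bound n)
eliminate L = concat (cartesianProductWith resolve L L)

-- Evaluation of affine functions in abelian and ordered groups

module Evaluation {c ℓ} (G : AbelianGroup c ℓ) (u : AbelianGroup.Carrier G) where
  open AbelianGroup G
    renaming
    ( _∙_ to infixl 6 _+_; ε to 0#; _⁻¹ to infix 8 -_
    ; ∙-cong to +-cong; ∙-congˡ to +-congˡ; ∙-congʳ to +-congʳ; assoc to +-assoc
    ; identityˡ to +-identityˡ; identityʳ to +-identityʳ; inverseʳ to -‿inverseʳ
    )
  open import Algebra.Properties.CommutativeMonoid.Mult commutativeMonoid public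
    using (×-homo-1)
    renaming
    ( _×_ to infixr 7 _·_; ×-homo-+ to ·-homo-+; ×-distrib-+ to ·-distrib-+
    ; ×-assocˡ to ·-assoc; ×-congʳ to ·-congʳ; ×-congˡ to ·-congˡ
    )
  open import Algebra.Properties.CommutativeSemigroup commutativeSemigroup using (interchange)
  open import Relation.Binary.Reasoning.Setoid setoid

  signed : ℕ → ℕ → Carrier → Carrier
  signed p q x = p · x + q · - x

  ⟦_⟧ : ∀ {n} → Form n → Vector Carrier n → Carrier
  ⟦ const p q ⟧   ρ = signed p q u
  ⟦ coeff p q f ⟧ ρ = signed p q (ρ zero) + ⟦ f ⟧ (ρ ∘ suc)

  ·-0 : ∀ k → k · 0# ≈ 0#
  ·-0 zero    = refl
  ·-0 (suc k) = trans (+-identityˡ _) (·-0 k)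

  signed-+ : ∀ p q p′ q′ x → signed (p ℕ.+ p′) (q ℕ.+ q′) x ≈ signed p q x + signed p′ q′ x
  signed-+ p q p′ q′ x = trans (+-cong (·-homo-+ x p p′) (·-homo-+ (- x) q q′)) (interchange _ _ _ _)

  signed-* : ∀ k p q x → signed (k ℕ.* p) (k ℕ.* q) x ≈ k · signed p q x
  signed-* k p q x = trans (+-cong (sym (·-assoc x k p)) (sym (·-assoc (- x) k q))) (sym (·-distrib-+ _ _ k))

  ⟦⊞⟧ : ∀ {n} (f g : Form n) ρ → ⟦ f ⊞ g ⟧ ρ ≈ ⟦ f ⟧ ρ + ⟦ g ⟧ ρ
  ⟦⊞⟧ (const p q)   (const p′ q′)   ρ = signed-+ p q p′ q′ u
  ⟦⊞⟧ (coeff p q f) (coeff p′ q′ g) ρ =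
    trans (+-cong (signed-+ p q p′ q′ (ρ zero)) (⟦⊞⟧ f g (ρ ∘ suc))) (interchange _ _ _ _)

  ⟦⊡⟧ : ∀ {n} k (f : Form n) ρ → ⟦ k ⊡ f ⟧ ρ ≈ k · ⟦ f ⟧ ρ
  ⟦⊡⟧ k (const p q)   ρ = signed-* k p q u
  ⟦⊡⟧ k (coeff p q f) ρ = trans (+-cong (signed-* k p q (ρ zero)) (⟦⊡⟧ k f (ρ ∘ suc))) (sym (·-distrib-+ _ _ k))

  signed-00+ : ∀ x {y} → signed 0 0 x + y ≈ y
  signed-00+ x = trans (+-congʳ (+-identityˡ 0#)) (+-identityˡ _)

  ⟦unitForm⟧ : ∀ {n} p q ρ → ⟦ unitForm {n} p q ⟧ ρ ≈ signed p q u
  ⟦unitForm⟧ {zero}  p q ρ = refl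
  ⟦unitForm⟧ {suc n} p q ρ = trans (signed-00+ (ρ zero)) (⟦unitForm⟧ p q (ρ ∘ suc))

  ⟦varForm⟧ : ∀ {n} (i : Fin n) p q ρ → ⟦ varForm i p q ⟧ ρ ≈ signed p q (ρ i)
  ⟦varForm⟧ zero    p q ρ = trans (+-congˡ (trans (⟦unitForm⟧ 0 0 (ρ ∘ suc)) (+-identityˡ 0#))) (+-identityʳ _)
  ⟦varForm⟧ (suc i) p q ρ = trans (signed-00+ (ρ zero)) (⟦varForm⟧ i p q (ρ ∘ suc))

  signed-0 : ∀ x → signed 0 0 x ≈ 0#
  signed-0 x = +-identityˡ 0#

  signed-1 : ∀ x → signed 1 0 x ≈ x
  signed-1 x = trans (+-identityʳ _) (×-homo-1 x)

  signed-−1 : ∀ x → signed 0 1 x ≈ - x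
  signed-−1 x = trans (+-identityˡ _) (×-homo-1 (- x))

  ⟦_⟧ₛ : Sign → Carrier → Carrier
  ⟦ none ⟧ₛ  x = 0#
  ⟦ pos k ⟧ₛ x = suc k · x
  ⟦ neg k ⟧ₛ x = suc k · - x

  ·-inverse : ∀ k x → k · x + k · - x ≈ 0#
  ·-inverse k x = trans (sym (·-distrib-+ x (- x) k)) (trans (·-congʳ k (-‿inverseʳ x)) (·-0 k))

  sign-correct : ∀ p q x → signed p q x ≈ ⟦ sign p q ⟧ₛ x
  sign-correct p q x with ℕ.compare p q
  ... | ℕ.equal _     = ·-inverse p x
  ... | ℕ.less _ k    = begin
    p · x + suc (p ℕ.+ k) · - x           ≈⟨ +-congˡ (·-congˡ (ℕₚ.+-suc p k)) ⟨
    p · x + (p ℕ.+ suc k) · - x           ≈⟨ +-congˡ (·-homo-+ (- x) p (suc k)) ⟩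
    p · x + (p · - x + suc k · - x)       ≈⟨ +-assoc _ _ _ ⟨
    p · x + p · - x + suc k · - x         ≈⟨ +-congʳ (·-inverse p x) ⟩
    0# + suc k · - x                      ≈⟨ +-identityˡ _ ⟩
    suc k · - x                           ∎
  ... | ℕ.greater _ k = begin
    suc (q ℕ.+ k) · x + q · - x           ≈⟨ +-congʳ (·-congˡ (≡.trans (ℕₚ.+-comm (suc k) q) (ℕₚ.+-suc q k))) ⟨
    (suc k ℕ.+ q) · x + q · - x           ≈⟨ +-congʳ (·-homo-+ x (suc k) q) ⟩
    suc k · x + q · x + q · - x           ≈⟨ +-assoc _ _ _ ⟩
    suc k · x + (q · x + q · - x)         ≈⟨ +-congˡ (·-inverse q x) ⟩
    suc k · x + 0#                        ≈⟨ +-identityʳ _ ⟩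
    suc k · x                             ∎

  -- The multiples of x cancel.
  ⟦combine⟧ : ∀ {n} k l (b b′ : Bound n) x ρ →
    suc l · (suc k · x + ⟦ form b ⟧ ρ) + suc k · (suc l · - x + ⟦ form b′ ⟧ ρ) ≈ ⟦ form (combine k l b b′) ⟧ ρ
  ⟦combine⟧ k l (f /1+ w) (g /1+ v) x ρ = begin
    suc l · (suc k · x + ⟦ f ⟧ ρ) + suc k · (suc l · - x + ⟦ g ⟧ ρ)
      ≈⟨ +-cong (·-distrib-+ _ _ (suc l)) (·-distrib-+ _ _ (suc k)) ⟩
    suc l · suc k · x + suc l · ⟦ f ⟧ ρ + (suc k · suc l · - x + suc k · ⟦ g ⟧ ρ)
      ≈⟨ interchange _ _ _ _ ⟩
    suc l · suc k · x + suc k · suc l · - x + (suc l · ⟦ f ⟧ ρ + suc k · ⟦ g ⟧ ρ)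
      ≈⟨ +-cong zeroPart (+-cong (⟦⊡⟧ (suc l) f ρ) (⟦⊡⟧ (suc k) g ρ)) ⟨
    0# + (⟦ suc l ⊡ f ⟧ ρ + ⟦ suc k ⊡ g ⟧ ρ)
      ≈⟨ trans (+-identityˡ _) (sym (⟦⊞⟧ (suc l ⊡ f) (suc k ⊡ g) ρ)) ⟩
    ⟦ suc l ⊡ f ⊞ suc k ⊡ g ⟧ ρ
      ∎
    where
    zeroPart : 0# ≈ suc l · suc k · x + suc k · suc l · - x
    zeroPart = sym (begin
      suc l · suc k · x + suc k · suc l · - x            ≈⟨ +-cong (·-assoc x (suc l) (suc k)) (·-assoc (- x) (suc k) (suc l)) ⟩
      (suc l ℕ.* suc k) · x + (suc k ℕ.* suc l) · - x    ≈⟨ +-congʳ (·-congˡ (ℕₚ.*-comm (suc l) (suc k))) ⟩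
      (suc k ℕ.* suc l) · x + (suc k ℕ.* suc l) · - x    ≈⟨ ·-inverse (suc k ℕ.* suc l) x ⟩
      0#                                                 ∎)

module OrderedEvaluation {c ℓ₁ ℓ₂} (O : OrderedGroup c ℓ₁ ℓ₂) (u : OrderedGroup.Carrier O) where
  open OrderedGroup O
  open Evaluation abelianGroup u public
  open IsPreorder isPreorder public
    using ()
    renaming
    ( refl to ≤-refl; reflexive to ≤-reflexive; trans to ≤-trans
    ; ≲-respˡ-≈ to ≤-respˡ; ≲-respʳ-≈ to ≤-respʳ
    )

  +-monoʳ-≤ : ∀ z {x y} → x ≤ y → z + x ≤ z + y
  +-monoʳ-≤ z {x} {y} p = ≤-respˡ (+-comm x z) (≤-respʳ (+-comm y z) (+-monoˡ-≤ z p))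

  +-mono-≤ : ∀ {x y z w} → x ≤ y → z ≤ w → x + z ≤ y + w
  +-mono-≤ {y = y} {z} p q = ≤-trans (+-monoˡ-≤ z p) (+-monoʳ-≤ y q)

  ·-mono-≤ : ∀ k {x y} → x ≤ y → k · x ≤ k · y
  ·-mono-≤ zero    p = ≤-refl
  ·-mono-≤ (suc k) p = +-mono-≤ p (·-mono-≤ k p)

  x+y-y≈x : ∀ x y → x + y + - y ≈ x
  x+y-y≈x x y = trans (+-assoc x y (- y)) (trans (+-congˡ (-‿inverseʳ y)) (+-identityʳ x))

  x-y+y≈x : ∀ x y → x + - y + y ≈ x
  x-y+y≈x x y = trans (+-assoc x (- y) y) (trans (+-congˡ (-‿inverseˡ y)) (+-identityʳ x))

  x+y≤z⇒x≤z-y : ∀ {x y z} → x + y ≤ z → x ≤ z + - y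
  x+y≤z⇒x≤z-y {x} {y} p = ≤-respˡ (x+y-y≈x x y) (+-monoˡ-≤ (- y) p)

  x≤z-y⇒x+y≤z : ∀ {x y z} → x ≤ z + - y → x + y ≤ z
  x≤z-y⇒x+y≤z {x} {y} {z} p = ≤-respʳ (x-y+y≈x z y) (+-monoˡ-≤ y p)

  +-cancelʳ-≤ : ∀ {x y z} → x + z ≤ y + z → x ≤ y
  +-cancelʳ-≤ {x} {y} {z} p = ≤-respʳ (x+y-y≈x y z) (x+y≤z⇒x≤z-y p)

  -‿anti-≤ : ∀ {x y} → x ≤ y → - y ≤ - x
  -‿anti-≤ {x} {y} p = ≤-respʳ (+-identityˡ (- x)) (x+y≤z⇒x≤z-y
    (≤-respʳ (-‿inverseˡ y) (+-monoʳ-≤ (- y) p)))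

  0≤x⇒-x≤0 : ∀ {x} → 0# ≤ x → - x ≤ 0#
  0≤x⇒-x≤0 {x} p = ≤-respˡ (+-identityˡ (- x)) (≤-respʳ (-‿inverseʳ x) (+-monoˡ-≤ (- x) p))

  module _ {n} (ρ : Vector Carrier n) where

    infix 4 _≼_

    -- The quotient by w + 1 need not exist in the group, so the bound is stated with the
    -- denominator cleared.
    record _≼_ (x : Carrier) (b : Bound n) : Set ℓ₂ where
      constructor mk≼
      field multiple≤ : suc (pred b) · x ≤ ⟦ form b ⟧ ρ

    ≼-trans : ∀ {x y b} → x ≤ y → y ≼ b → x ≼ b
    ≼-trans {b = f /1+ w} p (mk≼ q) = mk≼ (≤-trans (·-mono-≤ (suc w) p) q)

    ≼-form : ∀ {x} f → x ≤ ⟦ f ⟧ ρ → x ≼ (f /1+ 0)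
    ≼-form {x} f p = mk≼ (≤-respˡ (sym (×-homo-1 x)) p)

    ≼-+ᴮ : ∀ {x y b b′} → x ≼ b → y ≼ b′ → x + y ≼ b +ᴮ b′
    ≼-+ᴮ {x} {y} {f /1+ w} {g /1+ v} (mk≼ p) (mk≼ q) = mk≼ (≤-respˡ (sym left)
      (≤-respʳ (sym right) (+-mono-≤ (·-mono-≤ (suc v) p) (·-mono-≤ (suc w) q))))
      where
      left : (suc v ℕ.* suc w) · (x + y) ≈ suc v · suc w · x + suc w · suc v · y
      left = trans (·-distrib-+ x y (suc v ℕ.* suc w)) (+-cong (sym (·-assoc x (suc v) (suc w)))
        (trans (·-congˡ (ℕₚ.*-comm (suc v) (suc w))) (sym (·-assoc y (suc w) (suc v)))))
      right : ⟦ suc v ⊡ f ⊞ suc w ⊡ g ⟧ ρ ≈ suc v · ⟦ f ⟧ ρ + suc w · ⟦ g ⟧ ρ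
      right = trans (⟦⊞⟧ (suc v ⊡ f) (suc w ⊡ g) ρ) (+-cong (⟦⊡⟧ (suc v) f ρ) (⟦⊡⟧ (suc w) g ρ))

    ≼-halfᴮ : ∀ {x b} → x + x ≼ b → x ≼ halfᴮ b
    ≼-halfᴮ {x} {f /1+ w} (mk≼ p) =
      mk≼ (≤-respˡ (trans (·-congʳ (suc w) (+-congˡ (sym (×-homo-1 x)))) (·-assoc x (suc w) 2)) p)

  resolve-sound : ∀ {n} (ρ : Vector Carrier (suc n)) {m} b b′ →
    _≼_ ρ m b → _≼_ ρ m b′ → All (_≼_ (ρ ∘ suc) m) (resolve b b′)
  resolve-sound ρ {m} (coeff p q f /1+ w) (coeff p′ q′ g /1+ v) (mk≼ h) (mk≼ h′) = signedSound (sign p q) (sign p′ q′)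
    (≤-respʳ (+-congʳ (sign-correct p q (ρ zero))) h)
    (≤-respʳ (+-congʳ (sign-correct p′ q′ (ρ zero))) h′)
    where
    x = ρ zero
    ρ′ = ρ ∘ suc
    signedSound : ∀ s s′ → suc w · m ≤ ⟦ s ⟧ₛ x + ⟦ f ⟧ ρ′ → suc v · m ≤ ⟦ s′ ⟧ₛ x + ⟦ g ⟧ ρ′ →
      All (_≼_ ρ′ m) (resolveSigned s s′ (f /1+ w) (g /1+ v))
    signedSound none    _       h h′ = mk≼ (≤-respʳ (+-identityˡ _) h) ∷ []
    signedSound (pos k) (neg l) h h′ = mk≼ (≤-respˡ (sym left)
      (≤-respʳ (⟦combine⟧ k l (f /1+ w) (g /1+ v) x ρ′) (+-mono-≤ (·-mono-≤ (suc l) h) (·-mono-≤ (suc k) h′)))) ∷ []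
      where
      left : (suc l ℕ.* suc w ℕ.+ suc k ℕ.* suc v) · m ≈ suc l · suc w · m + suc k · suc v · m
      left = trans (·-homo-+ m (suc l ℕ.* suc w) (suc k ℕ.* suc v))
        (+-cong (sym (·-assoc m (suc l) (suc w))) (sym (·-assoc m (suc k) (suc v))))
    signedSound (pos _) none    h h′ = []
    signedSound (pos _) (pos _) h h′ = []
    signedSound (neg _) _       h h′ = []

  eliminate-sound : ∀ {n} (ρ : Vector Carrier (suc n)) {m} L →
    All (_≼_ ρ m) L → All (_≼_ (ρ ∘ suc) m) (eliminate L)
  eliminate-sound ρ L hs = Allₚ.concat⁺ (Allₚ.cartesianProductWith⁺ (≡.setoid _) (≡.setoid _) resolve L L
    λ {b} {b′} b∈L b′∈L → resolve-sound ρ b b′ (All.lookup hs b∈L) (All.lookup hs b′∈L))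

-- Joins of meets in lattice-ordered groups

Clause DNF : ℕ → Set
Clause n = List (Bound n)
DNF n = List (Clause n)

infixl 6 _+ᴰ_

_+ᴰ_ : ∀ {n} → DNF n → DNF n → DNF n
_+ᴰ_ = cartesianProductWith (cartesianProductWith _+ᴮ_)

halfᴰ : ∀ {n} → DNF n → DNF n
halfᴰ = map (map halfᴮ)

formᴰ : ∀ {n} → Form n → DNF n
formᴰ f = ((f /1+ 0) ∷ []) ∷ []

meetᴰ joinᴰ : ∀ {n} → DNF n → Form n → DNF n
meetᴰ D f = map ((f /1+ 0) ∷_) D
joinᴰ D f = ((f /1+ 0) ∷ []) ∷ D

module LatticeEvaluation {c ℓ₁ ℓ₂} (𝓖 : LatticeGroup c ℓ₁ ℓ₂) (u : LatticeGroup.Carrier 𝓖) where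
  open LatticeGroup 𝓖
  open OrderedEvaluation orderedGroup u public
  open import Algebra.Properties.AbelianGroup abelianGroup using (⁻¹-involutive)

  infixl 7 _∨_

  _∨_ : Carrier → Carrier → Carrier
  x ∨ y = - (- x ∧ - y)

  x≤x∨y : ∀ x y → x ≤ x ∨ y
  x≤x∨y x y = ≤-respˡ (⁻¹-involutive x) (-‿anti-≤ (x∧y≤x (- x) (- y)))

  y≤x∨y : ∀ x y → y ≤ x ∨ y
  y≤x∨y x y = ≤-respˡ (⁻¹-involutive y) (-‿anti-≤ (x∧y≤y (- x) (- y)))

  ∨-lub : ∀ {x y z} → x ≤ z → y ≤ z → x ∨ y ≤ z
  ∨-lub {z = z} p q = ≤-respʳ (⁻¹-involutive z) (-‿anti-≤ (∧-glb (-‿anti-≤ p) (-‿anti-≤ q)))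

  -- If (k+1)m ≤ 0, then J = 0 ∨ m ∨ … ∨ km satisfies m + J ≤ J ∨ (k+1)m = J.
  unperforated : ∀ k {m} → suc k · m ≤ 0# → m ≤ 0#
  unperforated k {m} km≤0 = +-cancelʳ-≤ (≤-respʳ (sym (+-identityˡ (J k)))
    (≤-trans (shift k) (∨-lub ≤-refl (≤-trans km≤0 (0≤J k)))))
    where
    J : ℕ → Carrier
    J zero    = 0#
    J (suc i) = J i ∨ (suc i · m)
    0≤J : ∀ i → 0# ≤ J i
    0≤J zero    = ≤-refl
    0≤J (suc i) = ≤-trans (0≤J i) (x≤x∨y _ _)
    shift : ∀ i → m + J i ≤ J (suc i)
    shift zero    = y≤x∨y _ _
    shift (suc i) = ≤-respˡ (+-comm _ m) (x≤z-y⇒x+y≤z (∨-lub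
      (x+y≤z⇒x≤z-y (≤-respˡ (+-comm m _) (≤-trans (shift i) (x≤x∨y _ _))))
      (x+y≤z⇒x≤z-y (≤-respˡ (+-comm m _) (y≤x∨y _ _)))))

  double-cancel-≤ : ∀ {x y} → x + x ≤ y + y → x ≤ y
  double-cancel-≤ {x} {y} p = ≤-respʳ (+-identityˡ y) (≤-respˡ (x-y+y≈x x y) (+-monoˡ-≤ y (unperforated 1 2d≤0)))
    where
    open import Algebra.Properties.CommutativeSemigroup commutativeSemigroup using (interchange)
    2d≤0 : 2 · (x + - y) ≤ 0#
    2d≤0 = ≤-respˡ (+-congˡ (sym (+-identityʳ _))) (≤-respˡ (interchange x x (- y) (- y))
      (≤-respʳ (trans (interchange y y (- y) (- y)) (trans (+-cong (-‿inverseʳ y) (-‿inverseʳ y)) (+-identityˡ 0#)))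
        (+-monoˡ-≤ (- y + - y) p)))

  x∧y+x∨y≤x+y : ∀ x y → x ∧ y + x ∨ y ≤ x + y
  x∧y+x∨y≤x+y x y = ≤-respˡ (+-comm _ _) (x≤z-y⇒x+y≤z (∨-lub
    (x+y≤z⇒x≤z-y (+-monoʳ-≤ x (x∧y≤y x y)))
    (x+y≤z⇒x≤z-y (≤-respˡ (+-comm _ _) (+-monoˡ-≤ y (x∧y≤x x y))))))

  -- The element x + y - z is below `x` because y ≤ z, and below `y` because x ≤ z. With z = `x ∨ y`
  -- this is the converse of `x∧y+x∨y≤x+y`.
  x+y≤x∧y+z : ∀ {x y z} → x ≤ z → y ≤ z → x + y ≤ x ∧ y + z
  x+y≤x∧y+z {x} {y} {z} p q = ≤-respˡ (x-y+y≈x (x + y) z) (+-monoˡ-≤ z (∧-glb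
    (≤-respʳ (x+y-y≈x x z) (+-monoˡ-≤ (- z) (+-monoʳ-≤ x q)))
    (≤-respʳ (trans (+-congʳ (+-comm z y)) (x+y-y≈x y z)) (+-monoˡ-≤ (- z) (+-monoˡ-≤ y p)))))

  module _ {n} (ρ : Vector Carrier n) where
    private
      _≼ρ_ = _≼_ ρ

    infix 4 _⊑_

    -- t lies below the join over C ∈ D of the meets of the bounds in C.
    _⊑_ : Carrier → DNF n → Set _
    t ⊑ D = ∀ z → (∀ {C m} → C ∈ D → m ≤ t → All (m ≼ρ_) C → m ≤ z) → t ≤ z

    ⊑-resp : ∀ {s t D} → s ≈ t → s ⊑ D → t ⊑ D
    ⊑-resp s≈t s⊑D z H = ≤-respˡ s≈t (s⊑D z λ C∈D m≤s → H C∈D (≤-respʳ s≈t m≤s))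

    ⊑-form : ∀ {t} f → t ≈ ⟦ f ⟧ ρ → t ⊑ formᴰ f
    ⊑-form f t≈f z H = H (here ≡.refl) ≤-refl (≼-form ρ f (≤-reflexive t≈f) ∷ [])

    -- Translations are invertible and so preserve joins: with one summand moved to the right-hand
    -- side, the pieces of `s` and of `t` are treated in turn.
    ⊑-+ : ∀ {s t D E} → s ⊑ D → t ⊑ E → s + t ⊑ D +ᴰ E
    ⊑-+ {s} {t} s⊑D t⊑E z H =
      x≤z-y⇒x+y≤z (s⊑D _ λ {C} {m} C∈D m≤s m≼C →
        x+y≤z⇒x≤z-y (≤-respˡ (+-comm t m) (x≤z-y⇒x+y≤z (t⊑E _ λ {C′} {m′} C′∈E m′≤t m′≼C′ →
          x+y≤z⇒x≤z-y (≤-respˡ (+-comm m m′)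
            (H (∈-cartesianProductWith⁺ (cartesianProductWith _+ᴮ_) C∈D C′∈E) (+-mono-≤ m≤s m′≤t)
              (Allₚ.cartesianProductWith⁺ (≡.setoid _) (≡.setoid _) _+ᴮ_ C C′ λ b∈C b′∈C′ →
                ≼-+ᴮ ρ (All.lookup m≼C b∈C) (All.lookup m′≼C′ b′∈C′))))))))

    -- The hypothesis is tested at `z + z`: a piece `m` below `s + s` gives the piece `half m` below
    -- `s`.
    ⊑-half : ∀ {s D} → s + s ⊑ D → s ⊑ halfᴰ D
    ⊑-half {s} {D} 2s⊑D z H = double-cancel-≤ (2s⊑D (z + z) λ {C} {m} C∈D m≤2s m≼C →
      let 2h≈m = half+half m
          hm≤z = H (∈-map⁺ (map halfᴮ) C∈D) (double-cancel-≤ (≤-respˡ (sym 2h≈m) m≤2s))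
                   (Allₚ.map⁺ (All.map (λ m≼b → ≼-halfᴮ ρ (≼-trans ρ (≤-reflexive 2h≈m) m≼b)) m≼C))
      in ≤-respˡ 2h≈m (+-mono-≤ hm≤z hm≤z))

    -- Distributivity of ∧ over the join, from x + y = x ∧ y + x ∨ y.
    ⊑-∧ : ∀ {t d D} f → d ≈ ⟦ f ⟧ ρ → t ⊑ D → t ∧ d ⊑ meetᴰ D f
    ⊑-∧ {t} {d} {D} f d≈f t⊑D z H = +-cancelʳ-≤
      (≤-trans (x∧y+x∨y≤x+y t d) (x≤z-y⇒x+y≤z (t⊑D _ λ {C} {m} C∈D m≤t m≼C →
        x+y≤z⇒x≤z-y (≤-trans (x+y≤x∧y+z (≤-trans m≤t (x≤x∨y t d)) (y≤x∨y t d))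
          (+-monoˡ-≤ (t ∨ d) (H (∈-map⁺ ((f /1+ 0) ∷_) C∈D)
            (∧-glb (≤-trans (x∧y≤x m d) m≤t) (x∧y≤y m d))
            (≼-form ρ f (≤-respʳ d≈f (x∧y≤y m d)) ∷ All.map (≼-trans ρ (x∧y≤x m d)) m≼C)))))))

    -- The element `s` is any least upper bound of `t` and `d`, because the joins that occur, such
    -- as the negative of a meet, do not have the form `t ∨ d`.
    ⊑-∨ : ∀ {s t d D} f → d ≈ ⟦ f ⟧ ρ → t ≤ s → d ≤ s → (∀ {z} → t ≤ z → d ≤ z → s ≤ z) → t ⊑ D → s ⊑ joinᴰ D f
    ⊑-∨ f d≈f t≤s d≤s s-lub t⊑D z H = s-lub
      (t⊑D z λ C∈D m≤t → H (there C∈D) (≤-trans m≤t t≤s))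
      (H (here ≡.refl) d≤s (≼-form ρ f (≤-reflexive d≈f) ∷ []))

-- Fourier–Motzkin elimination over ℚ

open import Data.Rational as ℚ using (ℚ; 0ℚ; 1ℚ; ½; _<_; _≤_; _+_; _*_; -_; _⊓_; _⊔_)
import Data.Rational.Properties as ℚₚ

-- With the order reversed, t ≼ f /1+ w says that f / (w + 1) ≤ t.
ℚᵒᵖ : OrderedGroup 0ℓ 0ℓ 0ℓ
ℚᵒᵖ = record
  { abelianGroup = ℚₚ.+-0-abelianGroup
  ; _≤_ = λ p q → q ≤ p
  ; isPreorder = record
    { isEquivalence = ≡.isEquivalence
    ; reflexive = λ p≡q → ℚₚ.≤-reflexive (≡.sym p≡q)
    ; trans = λ p q → ℚₚ.≤-trans q p
    }
  ; +-monoˡ-≤ = λ r → ℚₚ.+-monoˡ-≤ r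
  }

module 𝓠 = OrderedEvaluation ℚᵒᵖ 1ℚ
open 𝓠 using (_·_; ⟦_⟧; ⟦_⟧ₛ)

<⇒≱ : ∀ {p q} → p < q → q ≤ p → ⊥
<⇒≱ p<q q≤p = ℚₚ.<-irrefl ≡.refl (ℚₚ.<-≤-trans p<q q≤p)

·-mono-< : ∀ k {p q} → p < q → suc k · p < suc k · q
·-mono-< k p<q = ℚₚ.+-mono-<-≤ p<q (𝓠.·-mono-≤ k (ℚₚ.<⇒≤ p<q))

·≡* : ∀ k p → k · p ≡ (k · 1ℚ) * p
·≡* zero    p = ≡.sym (ℚₚ.*-zeroˡ p)
·≡* (suc k) p = ≡.sym (≡.trans (ℚₚ.*-distribʳ-+ p 1ℚ (k · 1ℚ)) (≡.cong₂ _+_ (ℚₚ.*-identityˡ p) (≡.sym (·≡* k p))))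

0<suc·1 : ∀ k → 0ℚ < suc k · 1ℚ
0<suc·1 k = ≡.subst (_< suc k · 1ℚ) (𝓠.·-0 (suc k)) (·-mono-< k (ℚₚ.positive⁻¹ 1ℚ))

divide : ∀ k p → ∃[ q ] suc k · q ≡ p
divide k p = ℚ.1/ d * p , (begin
  suc k · (ℚ.1/ d * p)  ≡⟨ ·≡* (suc k) _ ⟩
  d * (ℚ.1/ d * p)      ≡⟨ ℚₚ.*-assoc d (ℚ.1/ d) p ⟨
  d * ℚ.1/ d * p        ≡⟨ ≡.cong (_* p) (ℚₚ.*-inverseʳ d) ⟩
  1ℚ * p                ≡⟨ ℚₚ.*-identityˡ p ⟩
  p                     ∎)
  where
  open ≡.≡-Reasoning
  d = suc k · 1ℚ
  instance
    d≢0 : ℚ.NonZero d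
    d≢0 = ℚₚ.pos⇒nonZero d {{ℚ.positive (0<suc·1 k)}}

data Ray : Set where
  all         : Ray
  above below : ℚ → Ray

infix 4 _∈ᴿ_

_∈ᴿ_ : ℚ → Ray → Set
q ∈ᴿ all     = ⊤
q ∈ᴿ above a = a < q
q ∈ᴿ below b = q < b

-- The condition is asymmetric to match `resolveSigned`; a pair with the lower ray second is covered
-- by its transpose.
Compatible : Ray → Ray → Set
Compatible (above a) (below b) = a < b
Compatible (above _) all       = ⊤
Compatible (above _) (above _) = ⊤
Compatible all       _         = ⊤
Compatible (below _) _         = ⊤

⊔-< : ∀ {p q r} → p < r → q < r → p ⊔ q < r
⊔-< {p} {q} p<r q<r with ℚₚ.⊔-sel p q
... | inj₁ eq = ≡.subst (_< _) (≡.sym eq) p<r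
... | inj₂ eq = ≡.subst (_< _) (≡.sym eq) q<r

<-⊓ : ∀ {p q r} → r < p → r < q → r < p ⊓ q
<-⊓ {p} {q} r<p r<q with ℚₚ.⊓-sel p q
... | inj₁ eq = ≡.subst (_ <_) (≡.sym eq) r<p
... | inj₂ eq = ≡.subst (_ <_) (≡.sym eq) r<q

p<p+1 : ∀ p → p < p + 1ℚ
p<p+1 p = ≡.subst (_< p + 1ℚ) (ℚₚ.+-identityʳ p) (ℚₚ.+-monoʳ-< p (ℚₚ.positive⁻¹ 1ℚ))

p-1<p : ∀ p → p + - 1ℚ < p
p-1<p p = ≡.subst (p + - 1ℚ <_) (ℚₚ.+-identityʳ p) (ℚₚ.+-monoʳ-< p (ℚₚ.negative⁻¹ (- 1ℚ)))

-- Density puts a value strictly between `a` and each upper endpoint, and their minimum is taken; a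
-- + 1 serves when there is no upper endpoint.
raise-above : ∀ a R → All (Compatible (above a)) R → ∃[ y ] (a < y × All (Compatible (above y)) R)
raise-above a []            []       = a + 1ℚ , p<p+1 a , []
raise-above a (all ∷ R)     (_ ∷ cs) = let y , a<y , ds = raise-above a R cs in y , a<y , tt ∷ ds
raise-above a (above _ ∷ R) (_ ∷ cs) = let y , a<y , ds = raise-above a R cs in y , a<y , tt ∷ ds
raise-above a (below b ∷ R) (a<b ∷ cs) =
  let y , a<y , ds = raise-above a R cs
      z , a<z , z<b = ℚₚ.<-dense a<b
  in y ⊓ z , <-⊓ a<y a<z , ℚₚ.≤-<-trans (ℚₚ.p⊓q≤q y z) z<b ∷ All.map (λ {r} → antitone r (ℚₚ.p⊓q≤p y z)) ds
  where
  antitone : ∀ r {p q} → p ≤ q → Compatible (above q) r → Compatible (above p) r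
  antitone all       _   _   = tt
  antitone (above _) _   _   = tt
  antitone (below _) p≤q q<b = ℚₚ.≤-<-trans p≤q q<b

lower-below : ∀ b R → All (λ r → Compatible r (below b)) R → ∃[ y ] (y < b × All (λ r → Compatible r (below y)) R)
lower-below b []            []       = b + - 1ℚ , p-1<p b , []
lower-below b (all ∷ R)     (_ ∷ cs) = let y , y<b , ds = lower-below b R cs in y , y<b , tt ∷ ds
lower-below b (below _ ∷ R) (_ ∷ cs) = let y , y<b , ds = lower-below b R cs in y , y<b , tt ∷ ds
lower-below b (above a ∷ R) (a<b ∷ cs) =
  let y , y<b , ds = lower-below b R cs
      z , a<z , z<b = ℚₚ.<-dense a<b
  in y ⊔ z , ⊔-< y<b z<b , ℚₚ.<-≤-trans a<z (ℚₚ.p≤q⊔p y z) ∷ All.map (λ {r} → monotone r (ℚₚ.p≤p⊔q y z)) ds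
  where
  monotone : ∀ r {p q} → p ≤ q → Compatible r (below p) → Compatible r (below q)
  monotone all       _   _   = tt
  monotone (below _) _   _   = tt
  monotone (above _) p≤q a<p = ℚₚ.<-≤-trans a<p p≤q

-- Helly's theorem for open rays on a line. A common point of the tail is pushed past the new
-- endpoint, only as far as the opposite rays allow.
commonPoint : ∀ R → (∀ {r s} → r ∈ R → s ∈ R → Compatible r s) → ∃[ q ] All (q ∈ᴿ_) R
commonPoint []            compat = 0ℚ , []
commonPoint (all ∷ R)     compat =
  let q , q∈R = commonPoint R λ r∈ s∈ → compat (there r∈) (there s∈) in q , tt ∷ q∈R
commonPoint (above a ∷ R) compat =
  let q , q∈R = commonPoint R λ r∈ s∈ → compat (there r∈) (there s∈)
      y , a<y , cs = raise-above a R (All.tabulate λ s∈ → compat (here ≡.refl) (there s∈))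
  in q ⊔ y , ℚₚ.<-≤-trans a<y (ℚₚ.p≤q⊔p q y) ∷ All.zipWith (λ {r} (q∈r , c) → move r q y q∈r c) (q∈R , cs)
  where
  move : ∀ r q y → q ∈ᴿ r → Compatible (above y) r → q ⊔ y ∈ᴿ r
  move all       q y _   _   = tt
  move (above _) q y a<q _   = ℚₚ.<-≤-trans a<q (ℚₚ.p≤p⊔q q y)
  move (below _) q y q<b y<b = ⊔-< q<b y<b
commonPoint (below b ∷ R) compat =
  let q , q∈R = commonPoint R λ r∈ s∈ → compat (there r∈) (there s∈)
      y , y<b , cs = lower-below b R (All.tabulate λ s∈ → compat (there s∈) (here ≡.refl))
  in q ⊓ y , ℚₚ.≤-<-trans (ℚₚ.p⊓q≤q q y) y<b ∷ All.zipWith (λ {r} (q∈r , c) → move r q y q∈r c) (q∈R , cs)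
  where
  move : ∀ r q y → q ∈ᴿ r → Compatible r (below y) → q ⊓ y ∈ᴿ r
  move all       q y _   _   = tt
  move (above _) q y a<q a<y = <-⊓ a<q a<y
  move (below _) q y q<b _   = ℚₚ.≤-<-trans (ℚₚ.p⊓q≤p q y) q<b

-- The solutions x of 0 < ⟦ s ⟧ₛ x + r, except that r is ignored when s = none.
ray : Sign → ℚ → Ray
ray none    r = all
ray (pos k) r = above (proj₁ (divide k (- r)))
ray (neg l) r = below (proj₁ (divide l r))

ray-sound : ∀ s r {x} → (s ≡ none → 0ℚ < r) → x ∈ᴿ ray s r → 0ℚ < ⟦ s ⟧ₛ x + r
ray-sound none    r 0<r _ = ≡.subst (0ℚ <_) (≡.sym (ℚₚ.+-identityˡ r)) (0<r ≡.refl)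
ray-sound (pos k) r {x} _ a<x = ≡.subst (_< suc k · x + r)
  (≡.trans (≡.cong (_+ r) (proj₂ (divide k (- r)))) (ℚₚ.+-inverseˡ r))
  (ℚₚ.+-monoˡ-< r (·-mono-< k a<x))
ray-sound (neg l) r {x} _ x<b = ≡.subst (_< suc l · - x + r)
  (≡.trans (ℚₚ.+-comm (suc l · - x) (suc l · x)) (𝓠.·-inverse (suc l) x))
  (ℚₚ.+-monoʳ-< (suc l · - x) (≡.subst (suc l · x <_) (proj₂ (divide l r)) (·-mono-< l x<b)))

module _ {n} (ρ : Vector ℚ n) where

  rayᴮ : Bound (suc n) → Ray
  rayᴮ (coeff p q f /1+ w) = ray (sign p q) (⟦ f ⟧ ρ)

  Positive : Bound n → Set
  Positive b = 0ℚ < ⟦ form b ⟧ ρ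

  -- If the upper endpoint q were at most the lower endpoint p, then at p the first bound vanishes
  -- and the second is at most 0. Their combination, which is free of the variable, would then not
  -- be positive.
  signs-compatible : ∀ s s′ b b′ → All Positive (resolveSigned s s′ b b′) →
    Compatible (ray s (⟦ form b ⟧ ρ)) (ray s′ (⟦ form b′ ⟧ ρ))
  signs-compatible none    _       b b′ _ = tt
  signs-compatible (pos _) none    b b′ _ = tt
  signs-compatible (pos _) (pos _) b b′ _ = tt
  signs-compatible (neg _) _       b b′ _ = tt
  signs-compatible (pos k) (neg l) b b′ (0<c ∷ []) = ℚₚ.≰⇒> λ q≤p → <⇒≱ 0<c
    (≡.subst (_≤ 0ℚ) (𝓠.⟦combine⟧ k l b b′ p ρ)
      (ℚₚ.≤-trans (ℚₚ.+-mono-≤ (𝓠.·-mono-≤ (suc l) {_} {suc k · p + ⟦ form b ⟧ ρ} (ℚₚ.≤-reflexive first))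
                               (𝓠.·-mono-≤ (suc k) (second q≤p)))
        (ℚₚ.≤-reflexive (≡.cong₂ _+_ (𝓠.·-0 (suc l)) (𝓠.·-0 (suc k))))))
    where
    p = proj₁ (divide k (- ⟦ form b ⟧ ρ))
    q = proj₁ (divide l (⟦ form b′ ⟧ ρ))
    first : suc k · p + ⟦ form b ⟧ ρ ≡ 0ℚ
    first = ≡.trans (≡.cong (_+ _) (proj₂ (divide k (- ⟦ form b ⟧ ρ)))) (ℚₚ.+-inverseˡ (⟦ form b ⟧ ρ))
    second : q ≤ p → suc l · - p + ⟦ form b′ ⟧ ρ ≤ 0ℚ
    second q≤p = ≡.subst (suc l · - p + ⟦ form b′ ⟧ ρ ≤_)
      (≡.trans (ℚₚ.+-comm (suc l · - p) (suc l · p)) (𝓠.·-inverse (suc l) p))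
      (ℚₚ.+-monoʳ-≤ (suc l · - p) (≡.subst (_≤ suc l · p) (proj₂ (divide l (⟦ form b′ ⟧ ρ))) (𝓠.·-mono-≤ (suc l) q≤p)))

  module _ (L : List (Bound (suc n))) (all>0 : All Positive (eliminate L)) where

    pairs>0 : ∀ {b b′} → b ∈ L → b′ ∈ L → All Positive (resolve b b′)
    pairs>0 b∈L b′∈L = All.lookup (Allₚ.concat⁻ all>0) (∈-cartesianProductWith⁺ resolve b∈L b′∈L)

    rays-compatible : ∀ {r s} → r ∈ map rayᴮ L → s ∈ map rayᴮ L → Compatible r s
    rays-compatible r∈ s∈ with ∈-map⁻ rayᴮ r∈ | ∈-map⁻ rayᴮ s∈
    ... | (coeff p q f /1+ w) , b∈L , ≡.refl | (coeff p′ q′ g /1+ v) , b′∈L , ≡.refl =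
      signs-compatible (sign p q) (sign p′ q′) (f /1+ w) (g /1+ v) (pairs>0 b∈L b′∈L)

    eliminate-complete : ∃[ x ] (∀ {b} → b ∈ L → 0ℚ < ⟦ form b ⟧ (x Vector.∷ ρ))
    eliminate-complete =
      let x , x∈R = commonPoint (map rayᴮ L) rays-compatible
      in x , λ {b} b∈L → positive x b b∈L (All.lookup x∈R (∈-map⁺ rayᴮ b∈L))
      where
      positive : ∀ x b → b ∈ L → x ∈ᴿ rayᴮ b → 0ℚ < ⟦ form b ⟧ (x Vector.∷ ρ)
      positive x (coeff p q f /1+ w) b∈L x∈r = ≡.subst (λ y → 0ℚ < y + ⟦ f ⟧ ρ) (≡.sym (𝓠.sign-correct p q x))
        (ray-sound (sign p q) (⟦ f ⟧ ρ) (λ eq → free eq (pairs>0 b∈L b∈L)) x∈r)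
        where
        -- Paired with itself, a bound without the variable is still in the eliminated list, hence
        -- positive by assumption.
        free : ∀ {s s′ b′} → s ≡ none → All Positive (resolveSigned s s′ (f /1+ w) b′) → 0ℚ < ⟦ f ⟧ ρ
        free ≡.refl (0<f ∷ []) = 0<f

NowherePositive : ∀ {n} → List (Bound n) → Set
NowherePositive {n} L = ∀ (ρ : Vector ℚ n) → Any (λ b → ⟦ form b ⟧ ρ ≤ 0ℚ) L

-- The contrapositive of `eliminate-complete`; deciding the finitely many inequalities makes it
-- constructive.
eliminate-nowherePositive : ∀ {n} (L : List (Bound (suc n))) → NowherePositive L → NowherePositive (eliminate L)
eliminate-nowherePositive L H ρ with Any.any? (λ b → ⟦ form b ⟧ ρ ℚ.≤? 0ℚ) (eliminate L)
... | yes p = p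
... | no ¬p =
  let x , positive = eliminate-complete ρ L (All.map ℚₚ.≰⇒> (Allₚ.¬Any⇒All¬ _ ¬p))
      b , b∈L , b≤0 = find (H (x Vector.∷ ρ))
  in ⊥-elim (<⇒≱ (positive b∈L) b≤0)

module _ {c ℓ₁ ℓ₂} (𝓖 : LatticeGroup c ℓ₁ ℓ₂) (u : LatticeGroup.Carrier 𝓖) where
  private
    module 𝓖 = LatticeGroup 𝓖
    module 𝓔 = LatticeEvaluation 𝓖 u

  -- A Farkas lemma: a meet of affine functions that is nowhere positive over ℚ is ≤ 0 in 𝓖.
  nowherePositive⇒≤0 : 𝓖.0# 𝓖.≤ u → ∀ {n} (L : List (Bound n)) → NowherePositive L →
    ∀ ρ {m} → All (𝓔._≼_ ρ m) L → m 𝓖.≤ 𝓖.0#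
  nowherePositive⇒≤0 0≤u {zero} L H ρ {m} hs = base _ (find (H Vector.[]))
    where
    -- With no variable left, a form is an integer multiple of the unit; because `0# ≤ u`, a
    -- non-positive integer gives a non-positive element.
    constant≤0 : ∀ s → ⟦ s ⟧ₛ 1ℚ ≤ 0ℚ → 𝓔.⟦ s ⟧ₛ u 𝓖.≤ 𝓖.0#
    constant≤0 none    _ = 𝓔.≤-refl
    constant≤0 (pos k) h = ⊥-elim (<⇒≱ (0<suc·1 k) h)
    constant≤0 (neg l) _ = 𝓔.≤-respʳ (𝓔.·-0 (suc l)) (𝓔.·-mono-≤ (suc l) (𝓔.0≤x⇒-x≤0 0≤u))
    base : ∀ ρ′ → ∃[ b ] (b ∈ L × ⟦ form b ⟧ ρ′ ≤ 0ℚ) → m 𝓖.≤ 𝓖.0#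
    base ρ′ ((const p q /1+ w) , b∈L , h) = 𝓔.unperforated w (𝓔.≤-trans (𝓔._≼_.multiple≤ (All.lookup hs b∈L))
      (𝓔.≤-respˡ (𝓖.sym (𝓔.sign-correct p q u)) (constant≤0 (sign p q) (≡.subst (_≤ 0ℚ) (𝓠.sign-correct p q 1ℚ) h))))
  nowherePositive⇒≤0 0≤u {suc n} L H ρ hs =
    nowherePositive⇒≤0 0≤u (eliminate L) (eliminate-nowherePositive L H) (ρ ∘ suc) (𝓔.eliminate-sound ρ L hs)

-- Normal forms of terms

-- dnf⁺ τ represents τ and dnf⁻ τ represents − τ; a variable x is read as
-- (x ∧ 1) ∨ 0, which makes every rational point admissible.
dnf⁺ dnf⁻ : ∀ {n} → Term n → DNF n
dnf⁺ (var i)  = joinᴰ (meetᴰ (formᴰ (varForm i 1 0)) (unitForm 1 0)) (unitForm 0 0)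
dnf⁺ `0       = formᴰ (unitForm 0 0)
dnf⁺ (τ `⊕ σ) = meetᴰ (dnf⁺ τ +ᴰ dnf⁺ σ) (unitForm 1 0)
dnf⁺ (`¬ τ)   = formᴰ (unitForm 1 0) +ᴰ dnf⁻ τ
dnf⁺ (`κ τ)   = halfᴰ (dnf⁺ τ +ᴰ formᴰ (unitForm 1 0))
dnf⁻ (var i)  = joinᴰ (meetᴰ (formᴰ (varForm i 0 1)) (unitForm 0 0)) (unitForm 0 1)
dnf⁻ `0       = formᴰ (unitForm 0 0)
dnf⁻ (τ `⊕ σ) = joinᴰ (dnf⁻ τ +ᴰ dnf⁻ σ) (unitForm 0 1)
dnf⁻ (`¬ τ)   = formᴰ (unitForm 0 1) +ᴰ dnf⁺ τ
dnf⁻ (`κ τ)   = halfᴰ (dnf⁻ τ +ᴰ formᴰ (unitForm 0 1))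

module _ {n} (ρ : Vector ℚ n) where

  infix 4 _⊒_

  -- t lies above the join over C ∈ D of the meets of the bounds in C.
  _⊒_ : ℚ → DNF n → Set
  t ⊒ D = All (Any (𝓠._≼_ ρ t)) D

  ⊒-form : ∀ {t} f → ⟦ f ⟧ ρ ≤ t → t ⊒ formᴰ f
  ⊒-form f f≤t = here (𝓠.≼-form ρ f f≤t) ∷ []

  ⊒-+ : ∀ {s t} D E → s ⊒ D → t ⊒ E → s + t ⊒ D +ᴰ E
  ⊒-+ D E s⊒D t⊒E = Allₚ.cartesianProductWith⁺ (≡.setoid _) (≡.setoid _) _ D E λ C∈D C′∈E →
    Anyₚ.cartesianProductWith⁺ _+ᴮ_ (𝓠.≼-+ᴮ ρ) (All.lookup s⊒D C∈D) (All.lookup t⊒E C′∈E)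

  ⊒-half : ∀ {s D} → s + s ⊒ D → s ⊒ halfᴰ D
  ⊒-half 2s⊒D = Allₚ.map⁺ (All.map (λ any → Anyₚ.map⁺ (Any.map (𝓠.≼-halfᴮ ρ) any)) 2s⊒D)

  -- The order on the rationals is linear, so a minimum equals one of its arguments: every clause
  -- keeps an old bound below `s` or can use the new one.
  ⊒-meet : ∀ {s t D} f → t ≤ s ⊎ ⟦ f ⟧ ρ ≤ s → t ⊒ D → s ⊒ meetᴰ D f
  ⊒-meet f (inj₁ t≤s) t⊒D = Allₚ.map⁺ (All.map (λ any → there (Any.map (𝓠.≼-trans ρ t≤s) any)) t⊒D)
  ⊒-meet f (inj₂ f≤s) t⊒D = Allₚ.map⁺ (All.map (λ _ → here (𝓠.≼-form ρ f f≤s)) t⊒D)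

  ⊒-join : ∀ {s t D} f → t ≤ s → ⟦ f ⟧ ρ ≤ s → t ⊒ D → s ⊒ joinᴰ D f
  ⊒-join f t≤s f≤s t⊒D = here (𝓠.≼-form ρ f f≤s) ∷ All.map (Any.map (𝓠.≼-trans ρ t≤s)) t⊒D

  ⟦0⟧ : ⟦ unitForm 0 0 ⟧ ρ ≡ 0ℚ
  ⟦0⟧ = 𝓠.⟦unitForm⟧ 0 0 ρ

  ⟦1⟧ : ⟦ unitForm 1 0 ⟧ ρ ≡ 1ℚ
  ⟦1⟧ = 𝓠.⟦unitForm⟧ 1 0 ρ

  ⟦-1⟧ : ⟦ unitForm 0 1 ⟧ ρ ≡ - 1ℚ
  ⟦-1⟧ = 𝓠.⟦unitForm⟧ 0 1 ρ

-- Rational points of the unit interval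

clip : ℚ → ℚ
clip p = 0ℚ ⊔ (1ℚ ⊓ p)

0≤clip : ∀ p → 0ℚ ≤ clip p
0≤clip p = ℚₚ.p≤p⊔q 0ℚ (1ℚ ⊓ p)

clip≤1 : ∀ p → clip p ≤ 1ℚ
clip≤1 p = ℚₚ.⊔-lub (ℚₚ.<⇒≤ (ℚₚ.positive⁻¹ 1ℚ)) (ℚₚ.p⊓q≤p 1ℚ p)

p≤clip∨1≤clip : ∀ p → p ≤ clip p ⊎ 1ℚ ≤ clip p
p≤clip∨1≤clip p with ℚₚ.⊓-sel 1ℚ p
... | inj₁ eq = inj₂ (≡.subst (_≤ clip p) eq (ℚₚ.p≤q⊔p 0ℚ (1ℚ ⊓ p)))
... | inj₂ eq = inj₁ (≡.subst (_≤ clip p) eq (ℚₚ.p≤q⊔p 0ℚ (1ℚ ⊓ p)))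

clip≤p∨clip≤0 : ∀ p → clip p ≤ p ⊎ clip p ≤ 0ℚ
clip≤p∨clip≤0 p with ℚₚ.⊔-sel 0ℚ (1ℚ ⊓ p)
... | inj₁ eq = inj₂ (ℚₚ.≤-reflexive eq)
... | inj₂ eq = inj₁ (ℚₚ.≤-trans (ℚₚ.≤-reflexive eq) (ℚₚ.p⊓q≤q 1ℚ p))

point : ℚ → I
point p = mkI (fromℚ (clip p))
  (λ ε 0<ε → always λ _ → ℚₚ.≤-trans (0≤clip p) (p≤p+ε _ (ℚₚ.<⇒≤ 0<ε)))
  (λ ε 0<ε → always λ _ → ℚₚ.≤-trans (clip≤1 p) (p≤p+ε _ (ℚₚ.<⇒≤ 0<ε)))

½-double : ∀ p → - (½ * p) + - (½ * p) ≡ - p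
½-double p = ≡.trans (≡.sym (ℚₚ.neg-distrib-+ (½ * p) (½ * p))) (≡.cong -_ (½p+½p≡p p))

neg-involutive : ∀ p → - - p ≡ p
neg-involutive = ⁻¹-involutive
  where open import Algebra.Properties.AbelianGroup ℚₚ.+-0-abelianGroup using (⁻¹-involutive)

module _ {n} (ρ : Vector ℚ n) where
  private
    _⊒ρ_ = _⊒_ ρ
    infix 4 _⊒ρ_

  ⊒-resp : ∀ {s t} D → s ≡ t → s ⊒ρ D → t ⊒ρ D
  ⊒-resp D s≡t = ≡.subst (_⊒ρ D) s≡t

  ⊒-0 : 0ℚ ⊒ρ formᴰ (unitForm 0 0)
  ⊒-0 = ⊒-form ρ (unitForm 0 0) (ℚₚ.≤-reflexive (⟦0⟧ ρ))

  ⊒-1 : 1ℚ ⊒ρ formᴰ (unitForm 1 0)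
  ⊒-1 = ⊒-form ρ (unitForm 1 0) (ℚₚ.≤-reflexive (⟦1⟧ ρ))

  ⊒-−1 : - 1ℚ ⊒ρ formᴰ (unitForm 0 1)
  ⊒-−1 = ⊒-form ρ (unitForm 0 1) (ℚₚ.≤-reflexive (⟦-1⟧ ρ))

  lower-var⁺ : ∀ i → clip (ρ i) ⊒ρ dnf⁺ (var i)
  lower-var⁺ i = ⊒-join ρ (unitForm 0 0) ℚₚ.≤-refl (≡.subst (_≤ clip (ρ i)) (≡.sym (⟦0⟧ ρ)) (0≤clip (ρ i)))
    (⊒-meet ρ (unitForm 1 0) clipped (⊒-form ρ (varForm i 1 0)
      (ℚₚ.≤-reflexive (≡.trans (𝓠.⟦varForm⟧ i 1 0 ρ) (𝓠.signed-1 (ρ i))))))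
    where
    clipped : ρ i ≤ clip (ρ i) ⊎ ⟦ unitForm 1 0 ⟧ ρ ≤ clip (ρ i)
    clipped with p≤clip∨1≤clip (ρ i)
    ... | inj₁ h = inj₁ h
    ... | inj₂ h = inj₂ (≡.subst (_≤ clip (ρ i)) (≡.sym (⟦1⟧ ρ)) h)

  lower-var⁻ : ∀ i → - clip (ρ i) ⊒ρ dnf⁻ (var i)
  lower-var⁻ i = ⊒-join ρ (unitForm 0 1) ℚₚ.≤-refl
    (≡.subst (_≤ - clip (ρ i)) (≡.sym (⟦-1⟧ ρ)) (ℚₚ.neg-antimono-≤ (clip≤1 (ρ i))))
    (⊒-meet ρ (unitForm 0 0) clipped (⊒-form ρ (varForm i 0 1)
      (ℚₚ.≤-reflexive (≡.trans (𝓠.⟦varForm⟧ i 0 1 ρ) (𝓠.signed-−1 (ρ i))))))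
    where
    clipped : - ρ i ≤ - clip (ρ i) ⊎ ⟦ unitForm 0 0 ⟧ ρ ≤ - clip (ρ i)
    clipped with clip≤p∨clip≤0 (ρ i)
    ... | inj₁ h = inj₁ (ℚₚ.neg-antimono-≤ h)
    ... | inj₂ h = inj₂ (≡.subst (_≤ - clip (ρ i)) (≡.sym (⟦0⟧ ρ)) (ℚₚ.neg-antimono-≤ h))

  lower-⊕⁺ : ∀ {p q} D E → p ⊒ρ D → q ⊒ρ E → 1ℚ ⊓ (p + q) ⊒ρ meetᴰ (D +ᴰ E) (unitForm 1 0)
  lower-⊕⁺ {p} {q} D E h k = ⊒-meet ρ (unitForm 1 0) truncated (⊒-+ ρ D E h k)
    where
    truncated : p + q ≤ 1ℚ ⊓ (p + q) ⊎ ⟦ unitForm 1 0 ⟧ ρ ≤ 1ℚ ⊓ (p + q)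
    truncated with ℚₚ.⊓-sel 1ℚ (p + q)
    ... | inj₁ eq = inj₂ (ℚₚ.≤-reflexive (≡.trans (⟦1⟧ ρ) (≡.sym eq)))
    ... | inj₂ eq = inj₁ (ℚₚ.≤-reflexive (≡.sym eq))

  lower-⊕⁻ : ∀ {p q} D E → - p ⊒ρ D → - q ⊒ρ E → - (1ℚ ⊓ (p + q)) ⊒ρ joinᴰ (D +ᴰ E) (unitForm 0 1)
  lower-⊕⁻ {p} {q} D E h k = ⊒-join ρ (unitForm 0 1)
    (ℚₚ.neg-antimono-≤ (ℚₚ.p⊓q≤q 1ℚ (p + q)))
    (≡.subst (_≤ - (1ℚ ⊓ (p + q))) (≡.sym (⟦-1⟧ ρ)) (ℚₚ.neg-antimono-≤ (ℚₚ.p⊓q≤p 1ℚ (p + q))))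
    (⊒-resp (D +ᴰ E) (≡.sym (ℚₚ.neg-distrib-+ p q)) (⊒-+ ρ D E h k))

  lower-¬⁺ : ∀ {p} D → - p ⊒ρ D → 1ℚ ℚ.- p ⊒ρ formᴰ (unitForm 1 0) +ᴰ D
  lower-¬⁺ D = ⊒-+ ρ (formᴰ (unitForm 1 0)) D ⊒-1

  lower-¬⁻ : ∀ {p} D → p ⊒ρ D → - (1ℚ ℚ.- p) ⊒ρ formᴰ (unitForm 0 1) +ᴰ D
  lower-¬⁻ {p} D h = ⊒-resp (formᴰ (unitForm 0 1) +ᴰ D)
    (≡.sym (≡.trans (ℚₚ.neg-distrib-+ 1ℚ (- p)) (≡.cong (- 1ℚ +_) (neg-involutive p))))
    (⊒-+ ρ (formᴰ (unitForm 0 1)) D ⊒-−1 h)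

  lower-κ⁺ : ∀ {p} D → p ⊒ρ D → ½ * (p + 1ℚ) ⊒ρ halfᴰ (D +ᴰ formᴰ (unitForm 1 0))
  lower-κ⁺ {p} D h = ⊒-half ρ (⊒-resp (D +ᴰ formᴰ (unitForm 1 0)) (≡.sym (½p+½p≡p (p + 1ℚ)))
    (⊒-+ ρ D (formᴰ (unitForm 1 0)) h ⊒-1))

  lower-κ⁻ : ∀ {p} D → - p ⊒ρ D → - (½ * (p + 1ℚ)) ⊒ρ halfᴰ (D +ᴰ formᴰ (unitForm 0 1))
  lower-κ⁻ {p} D h = ⊒-half ρ (⊒-resp (D +ᴰ formᴰ (unitForm 0 1))
    (≡.sym (≡.trans (½-double (p + 1ℚ)) (ℚₚ.neg-distrib-+ p 1ℚ)))
    (⊒-+ ρ D (formᴰ (unitForm 0 1)) h ⊒-−1))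

  value : Term n → ℚ
  value (var i)  = clip (ρ i)
  value `0       = 0ℚ
  value (τ `⊕ σ) = 1ℚ ⊓ (value τ + value σ)
  value (`¬ τ)   = 1ℚ ℚ.- value τ
  value (`κ τ)   = ½ * (value τ + 1ℚ)

  -- Rational points are constant sequences and the real operations act termwise, so no limit is
  -- involved.
  seq-eval : ∀ τ k → seq (real (eval [0,1] τ (point ∘ ρ))) k ≡ value τ
  seq-eval (var i)  k = ≡.refl
  seq-eval `0       k = ≡.refl
  seq-eval (τ `⊕ σ) k = ≡.cong₂ (λ p q → 1ℚ ⊓ (p + q)) (seq-eval τ k) (seq-eval σ k)
  seq-eval (`¬ τ)   k = ≡.cong (λ p → 1ℚ ℚ.- p) (seq-eval τ k)
  seq-eval (`κ τ)   k = ≡.cong (λ p → ½ * (p + 1ℚ)) (seq-eval τ k)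

  dnf⁺-lower : ∀ τ → value τ ⊒ρ dnf⁺ τ
  dnf⁻-lower : ∀ τ → - value τ ⊒ρ dnf⁻ τ
  dnf⁺-lower (var i)  = lower-var⁺ i
  dnf⁺-lower `0       = ⊒-0
  dnf⁺-lower (τ `⊕ σ) = lower-⊕⁺ (dnf⁺ τ) (dnf⁺ σ) (dnf⁺-lower τ) (dnf⁺-lower σ)
  dnf⁺-lower (`¬ τ)   = lower-¬⁺ (dnf⁻ τ) (dnf⁻-lower τ)
  dnf⁺-lower (`κ τ)   = lower-κ⁺ (dnf⁺ τ) (dnf⁺-lower τ)
  dnf⁻-lower (var i)  = lower-var⁻ i
  dnf⁻-lower `0       = ⊒-0
  dnf⁻-lower (τ `⊕ σ) = lower-⊕⁻ {value τ} {value σ} (dnf⁻ τ) (dnf⁻ σ) (dnf⁻-lower τ) (dnf⁻-lower σ)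
  dnf⁻-lower (`¬ τ)   = lower-¬⁻ (dnf⁺ τ) (dnf⁺-lower τ)
  dnf⁻-lower (`κ τ)   = lower-κ⁻ {value τ} (dnf⁻ τ) (dnf⁻-lower τ)

-- Transfer of inequalities from the rationals to continuous algebras

·-nonPositive : ∀ k {p} → p ≤ 0ℚ → k · p ≤ 0ℚ
·-nonPositive k {p} p≤0 = ≡.subst (k · p ≤_) (𝓠.·-0 k) (𝓠.·-mono-≤ k p≤0)

-- A as the unit interval [0,u] of a lattice-ordered group.
record Interval {c ℓ c′ ℓ₁ ℓ₂} (A : ContinuousAlgebra c ℓ) (𝓖 : LatticeGroup c′ ℓ₁ ℓ₂) : Set (c ⊔ˡ ℓ ⊔ˡ c′ ⊔ˡ ℓ₁ ⊔ˡ ℓ₂) where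
  private
    module A = ContinuousAlgebra A
  open LatticeGroup 𝓖 using (0#; _∧_) renaming (Carrier to G; -_ to -ᴳ_; _+_ to _+ᴳ_; _≤_ to _≤ᴳ_; _≈_ to _≈ᴳ_)
  field
    u          : G
    ι          : A.Carrier → G
    0≤ι        : ∀ x → 0# ≤ᴳ ι x
    ι≤u        : ∀ x → ι x ≤ᴳ u
    ι-cancel-≤ : ∀ {x y} → ι x ≤ᴳ ι y → MVArithmetic._≤_ A x y
    ι-0        : ι A.0̄ ≈ᴳ 0#
    ι-¬        : ∀ x → ι (A.¬ x) ≈ᴳ u +ᴳ -ᴳ ι x
    ι-κ        : ∀ x → ι (A.κ x) +ᴳ ι (A.κ x) ≈ᴳ ι x +ᴳ u
    ι-⊕        : ∀ x y → ι (x A.⊕ y) ≈ᴳ (ι x +ᴳ ι y) ∧ u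

envelope : ∀ {c ℓ} (A : ContinuousAlgebra c ℓ) → Interval A (Envelope.latticeGroup A)
envelope A = record
  { u = 1ᴳ ; ι = ι ; 0≤ι = 0≤ι ; ι≤u = ι≤1 ; ι-cancel-≤ = ι-cancel-≤
  ; ι-0 = ι-0 ; ι-¬ = ι-¬ ; ι-κ = ι-κ ; ι-⊕ = ι-⊕
  }
  where open Envelope A

module _ {c ℓ c′ ℓ₁ ℓ₂} {A : ContinuousAlgebra c ℓ} {𝓖 : LatticeGroup c′ ℓ₁ ℓ₂} (interval : Interval A 𝓖)
         {n} (a : Vector (ContinuousAlgebra.Carrier A) n) where
  open Interval interval
  private
    module 𝓖 = LatticeGroup 𝓖
    module 𝓔 = LatticeEvaluation 𝓖 u
  open 𝓖 using (_≈_; sym; trans; 0#) renaming (_+_ to _+ᴳ_; -_ to -ᴳ_; _≤_ to _≤ᴳ_)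
  open import Algebra.Properties.AbelianGroup 𝓖.abelianGroup using (⁻¹-∙-comm; ⁻¹-involutive; ε⁻¹≈ε)

  ιa : Vector 𝓖.Carrier n
  ιa = ι ∘ a

  ⟦0⟧ᴳ : 0# ≈ 𝓔.⟦ unitForm 0 0 ⟧ ιa
  ⟦0⟧ᴳ = sym (trans (𝓔.⟦unitForm⟧ 0 0 ιa) (𝓔.signed-0 u))

  ⟦1⟧ᴳ : u ≈ 𝓔.⟦ unitForm 1 0 ⟧ ιa
  ⟦1⟧ᴳ = sym (trans (𝓔.⟦unitForm⟧ 1 0 ιa) (𝓔.signed-1 u))

  ⟦-1⟧ᴳ : -ᴳ u ≈ 𝓔.⟦ unitForm 0 1 ⟧ ιa
  ⟦-1⟧ᴳ = sym (trans (𝓔.⟦unitForm⟧ 0 1 ιa) (𝓔.signed-−1 u))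

  ⟪_⟫ : Term n → 𝓖.Carrier
  ⟪ τ ⟫ = ι (eval A τ a)

  dnf⁺-upper : ∀ τ → 𝓔._⊑_ ιa ⟪ τ ⟫ (dnf⁺ τ)
  dnf⁻-upper : ∀ τ → 𝓔._⊑_ ιa (-ᴳ ⟪ τ ⟫) (dnf⁻ τ)
  -- Since 0 ≤ ι x ≤ u, the element equals (ι x ∧ u) ∨ 0, in agreement with the clipped reading of
  -- variables over the rationals.
  dnf⁺-upper (var i) = 𝓔.⊑-∨ ιa (unitForm 0 0) ⟦0⟧ᴳ (𝓖.x∧y≤x _ _) (0≤ι (a i))
    (λ x∧1≤z _ → 𝓔.≤-trans (𝓖.∧-glb 𝓔.≤-refl (ι≤u (a i))) x∧1≤z)
    (𝓔.⊑-∧ ιa (unitForm 1 0) ⟦1⟧ᴳ (𝓔.⊑-form ιa (varForm i 1 0)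
      (sym (trans (𝓔.⟦varForm⟧ i 1 0 ιa) (𝓔.signed-1 _)))))
  dnf⁺-upper `0 = 𝓔.⊑-form ιa (unitForm 0 0) (trans ι-0 ⟦0⟧ᴳ)
  dnf⁺-upper (τ `⊕ σ) = 𝓔.⊑-resp ιa (sym (ι-⊕ _ _))
    (𝓔.⊑-∧ ιa (unitForm 1 0) ⟦1⟧ᴳ (𝓔.⊑-+ ιa (dnf⁺-upper τ) (dnf⁺-upper σ)))
  dnf⁺-upper (`¬ τ) = 𝓔.⊑-resp ιa (sym (ι-¬ _))
    (𝓔.⊑-+ ιa (𝓔.⊑-form ιa (unitForm 1 0) ⟦1⟧ᴳ) (dnf⁻-upper τ))
  dnf⁺-upper (`κ τ) = 𝓔.⊑-half ιa (𝓔.⊑-resp ιa (sym (ι-κ _))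
    (𝓔.⊑-+ ιa (dnf⁺-upper τ) (𝓔.⊑-form ιa (unitForm 1 0) ⟦1⟧ᴳ)))
  dnf⁻-upper (var i) = 𝓔.⊑-∨ ιa (unitForm 0 1) ⟦-1⟧ᴳ (𝓖.x∧y≤x _ _) (𝓔.-‿anti-≤ (ι≤u (a i)))
    (λ -x∧0≤z _ → 𝓔.≤-trans (𝓖.∧-glb 𝓔.≤-refl (𝓔.0≤x⇒-x≤0 (0≤ι (a i)))) -x∧0≤z)
    (𝓔.⊑-∧ ιa (unitForm 0 0) ⟦0⟧ᴳ (𝓔.⊑-form ιa (varForm i 0 1)
      (sym (trans (𝓔.⟦varForm⟧ i 0 1 ιa) (𝓔.signed-−1 _)))))
  dnf⁻-upper `0 = 𝓔.⊑-form ιa (unitForm 0 0) (trans (𝓖.⁻¹-cong ι-0) (trans ε⁻¹≈ε ⟦0⟧ᴳ))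
  dnf⁻-upper (τ `⊕ σ) = 𝓔.⊑-∨ ιa (unitForm 0 1) ⟦-1⟧ᴳ
    (𝓔.≤-respˡ (sym (⁻¹-∙-comm _ _)) (𝓔.-‿anti-≤ (𝓔.≤-respˡ (sym (ι-⊕ _ _)) (𝓖.x∧y≤x _ _))))
    (𝓔.-‿anti-≤ (ι≤u _))
    (λ {z} h k → 𝓔.≤-respʳ (⁻¹-involutive z) (𝓔.-‿anti-≤ (𝓔.≤-respʳ (sym (ι-⊕ _ _)) (𝓖.∧-glb
      (𝓔.≤-respʳ (⁻¹-involutive _) (𝓔.-‿anti-≤ (𝓔.≤-respˡ (⁻¹-∙-comm _ _) h)))
      (𝓔.≤-respʳ (⁻¹-involutive _) (𝓔.-‿anti-≤ k))))))
    (𝓔.⊑-+ ιa (dnf⁻-upper τ) (dnf⁻-upper σ))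
  dnf⁻-upper (`¬ τ) = 𝓔.⊑-resp ιa
    (sym (trans (𝓖.⁻¹-cong (ι-¬ _)) (trans (sym (⁻¹-∙-comm _ _)) (𝓖.+-congˡ (⁻¹-involutive _)))))
    (𝓔.⊑-+ ιa (𝓔.⊑-form ιa (unitForm 0 1) ⟦-1⟧ᴳ) (dnf⁺-upper τ))
  dnf⁻-upper (`κ τ) = 𝓔.⊑-half ιa (𝓔.⊑-resp ιa
    (sym (trans (⁻¹-∙-comm _ _) (trans (𝓖.⁻¹-cong (ι-κ _)) (sym (⁻¹-∙-comm _ _)))))
    (𝓔.⊑-+ ιa (dnf⁻-upper τ) (𝓔.⊑-form ιa (unitForm 0 1) ⟦-1⟧ᴳ)))

  ≤-transfer : ∀ τ σ → (∀ ρ → value ρ τ ≤ value ρ σ) → MVArithmetic._≤_ A (eval A τ a) (eval A σ a)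
  ≤-transfer τ σ H = ι-cancel-≤ (𝓔.≤-respˡ (𝓔.x-y+y≈x ⟪ τ ⟫ ⟪ σ ⟫) (𝓔.≤-respʳ (𝓖.+-identityˡ ⟪ σ ⟫)
    (𝓖.+-monoˡ-≤ ⟪ σ ⟫ difference≤0)))
    where
    D = dnf⁺ τ +ᴰ dnf⁻ σ
    nowherePositive : ∀ {C} → C ∈ D → NowherePositive C
    nowherePositive C∈D ρ = Any.map (λ {b} → bound≤0 b)
      (All.lookup (⊒-+ ρ (dnf⁺ τ) (dnf⁻ σ) (dnf⁺-lower ρ τ) (dnf⁻-lower ρ σ)) C∈D)
      where
      d≤0 : value ρ τ + - value ρ σ ≤ 0ℚ
      d≤0 = ≡.subst (value ρ τ + - value ρ σ ≤_) (ℚₚ.+-inverseʳ (value ρ σ)) (ℚₚ.+-monoˡ-≤ _ (H ρ))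
      bound≤0 : ∀ b → 𝓠._≼_ ρ (value ρ τ + - value ρ σ) b → ⟦ form b ⟧ ρ ≤ 0ℚ
      bound≤0 (f /1+ w) (𝓠.mk≼ h) = ℚₚ.≤-trans h (·-nonPositive (suc w) d≤0)
    difference≤0 : ⟪ τ ⟫ +ᴳ (-ᴳ ⟪ σ ⟫) ≤ᴳ 0#
    -- Testing the join of meets at `0#` leaves, for each clause, an element below all its bounds,
    -- to which the Farkas lemma applies.
    difference≤0 = 𝓔.⊑-+ ιa (dnf⁺-upper τ) (dnf⁻-upper σ) 0# λ {C} C∈D _ →
      nowherePositive⇒≤0 𝓖 u 0≤1 C (nowherePositive C∈D) ιa
      where
      0≤1 : 0# ≤ᴳ u
      0≤1 = 𝓔.≤-trans (0≤ι (ContinuousAlgebra.0̄ A)) (ι≤u _)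

-- An excess d > 0 is a constant difference of two equal reals, so it is at most d/2, which is
-- absurd.
value-≤ : ∀ {n} (τ σ : Term n) → [0,1] ⊨ τ ≐ σ → ∀ ρ → value ρ τ ≤ value ρ σ
value-≤ τ σ H ρ = ℚₚ.≮⇒≥ λ σ<τ →
  let d = value ρ τ ℚ.- value ρ σ
      0<d = ≡.subst (_< d) (ℚₚ.+-inverseʳ (value ρ σ)) (ℚₚ.+-monoˡ-< (- value ρ σ) σ<τ)
      N , near = H (point ∘ ρ) (½ * d) (½>0 0<d)
      d≤½d = ℚₚ.≤-trans (p≤∣p∣ d) (≡.subst₂ (λ p q → ℚ.∣ p ℚ.- q ∣ ≤ ½ * d)
        (seq-eval ρ τ N) (seq-eval ρ σ N) (near N ℕₚ.≤-refl))
      d<½d+½d = ≡.subst (_< ½ * d + ½ * d) (ℚₚ.+-identityʳ (½ * d)) (ℚₚ.+-monoʳ-< (½ * d) (½>0 0<d))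
  in ℚₚ.<-irrefl ≡.refl (ℚₚ.<-≤-trans d<½d+½d (≡.subst (_≤ ½ * d) (≡.sym (½p+½p≡p d)) d≤½d))

[0,1]-complete : ∀ {n} (τ σ : Term n) → [0,1] ⊨ τ ≐ σ → ∀ {c ℓ} (A : ContinuousAlgebra c ℓ) → A ⊨ τ ≐ σ
[0,1]-complete τ σ H A a = MVArithmetic.≤-antisym A
  (≤-transfer (envelope A) a τ σ (value-≤ τ σ H))
  (≤-transfer (envelope A) a σ τ (value-≤ σ τ λ b → ≃ᴿ-sym {real (eval [0,1] τ b)} {real (eval [0,1] σ b)} (H b)))

-- Change of universe levels

module _ {c ℓ} (c′ ℓ′ : Level) (A : ContinuousAlgebra c ℓ) where
  open ContinuousAlgebra A

  -- The unit interval lives at level zero, whereas the theorem quantifies over algebras at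
  -- arbitrary levels; its forward direction is applied to a lifted copy.
  liftAlgebra : ContinuousAlgebra (c ⊔ˡ c′) (ℓ ⊔ˡ ℓ′)
  liftAlgebra = record
    { Carrier       = Lift c′ Carrier
    ; _≈_           = λ x y → Lift ℓ′ (lower x ≈ lower y)
    ; _⊕_           = λ x y → lift (lower x ⊕ lower y)
    ; ¬_            = λ x → lift (¬ lower x)
    ; 0̄             = lift 0̄
    ; κ             = λ x → lift (κ (lower x))
    ; isEquivalence = record
      { refl  = lift refl
      ; sym   = λ p → lift (sym (lower p))
      ; trans = λ p q → lift (trans (lower p) (lower q))
      }
    ; ⊕-cong        = λ p q → lift (⊕-cong (lower p) (lower q))
    ; ¬-cong        = λ p → lift (¬-cong (lower p))
    ; κ-cong        = λ p → lift (κ-cong (lower p))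
    ; C1            = λ x y z → lift (C1 (lower x) (lower y) (lower z))
    ; C2            = λ x y → lift (C2 (lower x) (lower y))
    ; C3            = λ x → lift (C3 (lower x))
    ; C4            = λ x → lift (C4 (lower x))
    ; C5            = λ x → lift (C5 (lower x))
    ; C6            = λ x y → lift (C6 (lower x) (lower y))
    ; C7            = λ x → lift (C7 (lower x))
    ; C8            = λ x y → lift (C8 (lower x) (lower y))
    }
    where open IsEquivalence isEquivalence using (refl; sym; trans)

  eval-lift : ∀ {n} (τ : Term n) a → lower (eval liftAlgebra τ (lift ∘ a)) ≡ eval A τ a
  eval-lift (var i)  a = ≡.refl
  eval-lift `0       a = ≡.refl
  eval-lift (τ `⊕ σ) a = ≡.cong₂ _⊕_ (eval-lift τ a) (eval-lift σ a)
  eval-lift (`¬ τ)   a = ≡.cong ¬_ (eval-lift τ a)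
  eval-lift (`κ τ)   a = ≡.cong κ (eval-lift τ a)

  lift-⊨ : ∀ {n} (e : Equation n) → liftAlgebra ⊨ e → A ⊨ e
  lift-⊨ (τ ≐ σ) H a = ≡.subst₂ _≈_ (eval-lift τ a) (eval-lift σ a) (lower (H (lift ∘ a)))

theorem6p1 : ∀ (c ℓ : Level) {n : ℕ} (e : Equation n) → (∀ (A : ContinuousAlgebra c ℓ) → A ⊨ e) ⇔ ([0,1] ⊨ e)
theorem6p1 c ℓ e@(τ ≐ σ) = mk⇔ (λ H → lift-⊨ c ℓ [0,1] e (H (liftAlgebra c ℓ [0,1]))) (λ H A → [0,1]-complete τ σ H A)
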